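{- Let $m\geqslant 2$ and $d\geqslant 2$ be integers, let $f(X)=a_dX^d+\ldots+a_1X+a_0\in\mathbb{Z}_m[X]$ be a polynomial of degree $d$ with $\gcd(a_d,m)=1$, and let $\mathcal{I}=\{1,\ldots,H\}$ with $1\leqslant H\leqslant m$. Then $$T_{f,m}(\mathcal{I})\leqslant\left(\frac{H^4}{m^{4/d(d+1)}}+H^2\right)H^{o(1)}.$$
   Context: $\mathbb{Z}_m$ denotes the residue ring modulo $m$. $T_{f,m}(\mathcal{I})$ is the number of quadruples $(x,y,z,w)\in\mathcal{I}^4$ with $f(x)+f(y)\equiv f(z)+f(w)\pmod m$. The notation $H^{o(1)}$ denotes a factor which, for every fixed $\varepsilon>0$, is at most $C(d,\varepsilon)H^{\varepsilon}$, with $C(d,\varepsilon)$ depending only on $d$ and $\varepsilon$. -}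

module Defs where

open import Data.Nat using (ℕ; zero; suc; _+_; _*_; _^_; _≡ᵇ_; NonZero)
open import Data.Nat.DivMod using (_%_)
open import Data.Fin using (Fin; toℕ)
open import Data.List using (List; map; upTo; allFin)
open import Data.Nat.ListAction using (sum)
open import Data.Bool using (if_then_else_)

-- A polynomial of formal degree d over Z_m, given by its coefficient vector
-- a : Fin (suc d) → ℕ  (a i is a representative of the coefficient a_i ∈ Z_m).
-- Its value at x (as a natural number; reduced mod m where relevant):
evalPoly : (d : ℕ) → (Fin (suc d) → ℕ) → ℕ → ℕ
evalPoly d a x = sum (map (λ i → a i * x ^ toℕ i) (allFin (suc d)))

lead : (d : ℕ) → (Fin (suc d) → ℕ) → ℕ
lead d a = a (Data.Fin.fromℕ d)

interval : ℕ → List ℕ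
interval H = map suc (upTo H)

Σ[∈_]_ : List ℕ → (ℕ → ℕ) → ℕ
Σ[∈ xs ] g = sum (map g xs)

T : (m : ℕ) .{{_ : NonZero m}} → (d : ℕ) → (Fin (suc d) → ℕ) → ℕ → ℕ
T m d a H =
  Σ[∈ I ] λ x → Σ[∈ I ] λ y → Σ[∈ I ] λ z → Σ[∈ I ] λ w →
    if ((f x + f y) % m) ≡ᵇ ((f z + f w) % m) then 1 else 0
  where
    I = interval H
    f = evalPoly d a

{-# OPTIONS --safe #-}
module Submission where

-- If H^(d(d+1)/2) is smaller than a constant times m, Dirichlet's theorem yields t < m such that each
-- t b_i is congruent modulo m to an integer e_i of size at most about m / H^i.  For a solution of
-- f x + f y ≡ f z + f w the moments u_i = x^i + y^i − z^i − w^i are O(H^i), so Σ e_i u_i is a multiple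
-- of m smaller than m: it vanishes.  Since m may exceed every power of H, a second use of
-- Dirichlet's theorem, with modulus max |e_i| over i ≥ 2, replaces e by coefficients polynomial in H,
-- not all zero in degrees ≥ 2.  All solutions thus satisfy g x − g z = g w − g y over ℤ with 2 ≤ deg g ≤ d;
-- as x − z divides a difference of size H^O(1), the divisor bound leaves H^(2+o(1)) of them.
-- For larger H, cut the interval into blocks of the critical length: by Cauchy–Schwarz the energy of
-- b blocks is at most b^4 times the largest energy of a single block.

open import Defs
open import Data.Bool using (true; false; if_then_else_)
open import Data.Fin using (Fin; fromℕ<; combine)
import Data.Fin as Fin
import Data.Fin.Properties as Fin
open import Data.Integer using (ℤ; 0ℤ) renaming (+_ to pos; ∣_∣ to abs)
import Data.Integer as ℤ
import Data.Integer.Properties as ℤ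
open import Data.Integer.DivMod using (_%ℕ_; _/ℕ_; n%ℕd<d; a≡a%ℕn+[a/ℕn]*n)
open import Data.Integer.Divisibility.Signed using (∣⇒∣ᵤ) renaming (_∣_ to _∣ℤ_; _∣?_ to _∣ℤ?_)
import Data.Integer.Divisibility.Signed as Signed
import Data.Integer.Tactic.RingSolver as ℤ-Ring
open import Data.List using (List; []; _∷_; _++_; map; filter; length; upTo; applyUpTo; tabulate; cartesianProduct)
open import Data.List.Properties using (length-map; map-∘; map-++; length-applyUpTo; map-upTo; map-tabulate; tabulate-cong)
open import Data.List.Membership.Propositional using (_∈_)
open import Data.List.Membership.Propositional.Properties using (∈-map⁻; ∈-map⁺; ∈-upTo⁻; ∈-upTo⁺; ∈-cartesianProduct⁻)
open import Data.List.Relation.Unary.All as All using (All; []; _∷_)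
import Data.List.Relation.Unary.All.Properties as All
open import Data.List.Relation.Unary.AllPairs using ([]; _∷_)
open import Data.List.Relation.Unary.Any using (here; there)
open import Data.List.Relation.Unary.Unique.Propositional using (Unique)
import Data.List.Relation.Unary.Unique.Propositional.Properties as Unique
open import Data.Nat using (ℕ; zero; suc; _+_; _*_; _∸_; _^_; _≤_; _<_; _≡ᵇ_; _⊔_; z≤n; s≤s; NonZero; ≢-nonZero; >-nonZero; >-nonZero⁻¹; _≟_; _≤?_; _<?_; n>1⇒nonTrivial)
open import Data.Nat.Coprimality using (Coprime; coprime-divisor)
import Data.Nat.Coprimality as Coprimality
open import Data.Nat.DivMod using (_%_; _/_; m≡m%n+[m/n]*n; m%n<n; m<n*o⇒m/o<n)
open import Data.Nat.Divisibility using (_∣_; divides; _∣?_; ∣⇒≤; n∣m*n; *-cancelˡ-∣; ∣1⇒≡1)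
open import Data.Nat.ListAction using (sum; product)
open import Data.Nat.ListAction.Properties using (sum-++; ∈⇒∣product)
open import Data.Nat.Primality using (Prime; _Rough_; 2-rough; rough∧∣⇒prime; ∤⇒rough-suc; rough∧∣⇒rough; rough⇒≤; prime⇒nonZero; prime⇒nonTrivial; prime⇒irreducible)
open import Data.Nat.Primality.Factorisation using (factorise; PrimeFactorisation)
open import Data.Nat.Properties hiding (_≟_; _≤?_; _<?_)
import Data.Nat.Tactic.RingSolver as ℕ-Ring
open import Data.Product using (∃; Σ; _×_; _,_; proj₁; proj₂)
open import Data.Sum using (_⊎_; inj₁; inj₂)
open import Function using (_∘_; id)
open import Relation.Binary.PropositionalEquality using (_≡_; _≢_; refl; sym; trans; cong; cong₂; subst; subst₂; module ≡-Reasoning)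
open import Relation.Nullary using (¬_; Dec; yes; no; contradiction)
open import Relation.Binary using (tri<; tri≈; tri>)
open import Relation.Nullary.Decidable using (¬?)
open import Relation.Unary using (Decidable)

-- The blocks of a long interval carry the shifted polynomials f(s + x), whose lower coefficients
-- are arbitrary modulo m. The bound for short intervals must therefore be uniform in everything
-- except the degree, the coprimality of the leading coefficient to m, and the length. Coprimality
-- enters only to make e_d nonzero: m cannot divide t a_d when 1 ≤ t < m. The relation over ℤ has to
-- be nontrivial beyond degree 1, because x + y = z + w alone has about H³ solutions. A linear
-- coefficient e_1 far larger than the others would spoil the second approximation, whose modulus
-- ignores it. In that case, however, the relation forces u_1 = 0, and e_1 may be replaced by 0.
-- Real exponents never appear. The number ε is 1/k, every bound is raised to the power N = d(d+1)k,
-- and roots are rounded down to integers.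

private
  variable
    A B : Set

-- Finite sums, indicators and counting

∑ : List A → (A → ℕ) → ℕ
∑ xs g = sum (map g xs)

∑-cong : ∀ (xs : List A) {g h} → (∀ x → g x ≡ h x) → ∑ xs g ≡ ∑ xs h
∑-cong []       eq = refl
∑-cong (x ∷ xs) eq = cong₂ _+_ (eq x) (∑-cong xs eq)

∑-mono-∈ : ∀ (xs : List A) {g h} → (∀ {x} → x ∈ xs → g x ≤ h x) → ∑ xs g ≤ ∑ xs h
∑-mono-∈ []       le = z≤n
∑-mono-∈ (x ∷ xs) le = +-mono-≤ (le (here refl)) (∑-mono-∈ xs (le ∘ there))

∑-mono : ∀ (xs : List A) {g h} → (∀ x → g x ≤ h x) → ∑ xs g ≤ ∑ xs h
∑-mono xs le = ∑-mono-∈ xs (λ {x} _ → le x)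

∑-+ : ∀ (xs : List A) g h → ∑ xs (λ x → g x + h x) ≡ ∑ xs g + ∑ xs h
∑-+ []       g h = refl
∑-+ (x ∷ xs) g h = trans (cong (λ s → g x + h x + s) (∑-+ xs g h)) (interchange (g x) (h x) _ _)
  where
  interchange : ∀ a b c d → a + b + (c + d) ≡ a + c + (b + d)
  interchange = ℕ-Ring.solve-∀

∑-*ˡ : ∀ (xs : List A) c g → ∑ xs (λ x → c * g x) ≡ c * ∑ xs g
∑-*ˡ []       c g = sym (*-zeroʳ c)
∑-*ˡ (x ∷ xs) c g = trans (cong (c * g x +_) (∑-*ˡ xs c g)) (sym (*-distribˡ-+ c (g x) _))

∑-*ʳ : ∀ (xs : List A) c g → ∑ xs (λ x → g x * c) ≡ ∑ xs g * c
∑-*ʳ xs c g = trans (∑-cong xs (λ x → *-comm (g x) c)) (trans (∑-*ˡ xs c g) (*-comm c _))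

∑-≤-const : ∀ (xs : List A) {g c} → (∀ {x} → x ∈ xs → g x ≤ c) → ∑ xs g ≤ length xs * c
∑-≤-const []       le = z≤n
∑-≤-const (x ∷ xs) le = +-mono-≤ (le (here refl)) (∑-≤-const xs (le ∘ there))

∑-zero : ∀ (xs : List A) → ∑ xs (λ _ → 0) ≡ 0
∑-zero []       = refl
∑-zero (x ∷ xs) = ∑-zero xs

∑-swap : ∀ (xs : List A) (ys : List B) (g : A → B → ℕ) →
         ∑ xs (λ x → ∑ ys (λ y → g x y)) ≡ ∑ ys (λ y → ∑ xs (λ x → g x y))
∑-swap []       ys g = sym (∑-zero ys)
∑-swap (x ∷ xs) ys g = trans (cong (∑ ys (g x) +_) (∑-swap xs ys g)) (sym (∑-+ ys (g x) _))

∑-++ : ∀ (xs ys : List A) g → ∑ (xs ++ ys) g ≡ ∑ xs g + ∑ ys g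
∑-++ xs ys g = trans (cong sum (map-++ g xs ys)) (sum-++ (map g xs) (map g ys))

∑-map : ∀ (xs : List A) (φ : A → B) g → ∑ (map φ xs) g ≡ ∑ xs (g ∘ φ)
∑-map xs φ g = cong sum (sym (map-∘ xs))

∑-× : ∀ (xs : List A) (ys : List B) g →
      ∑ (cartesianProduct xs ys) g ≡ ∑ xs (λ x → ∑ ys (λ y → g (x , y)))
∑-× []       ys g = refl
∑-× (x ∷ xs) ys g = trans (∑-++ (map (x ,_) ys) (cartesianProduct xs ys) g)
                          (cong₂ _+_ (∑-map ys (x ,_) g) (∑-× xs ys g))

∑-*-∑ : ∀ (xs : List A) (ys : List B) g h →
        ∑ xs (λ x → ∑ ys (λ y → g x * h y)) ≡ ∑ xs g * ∑ ys h
∑-*-∑ xs ys g h = trans (∑-cong xs (λ x → ∑-*ˡ ys (g x) h)) (∑-*ʳ xs (∑ ys h) g)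

𝟙 : {P : Set} → Dec P → ℕ
𝟙 (yes _) = 1
𝟙 (no _)  = 0

𝟙-yes : {P : Set} (P? : Dec P) → P → 𝟙 P? ≡ 1
𝟙-yes (yes _) p = refl
𝟙-yes (no ¬p) p = contradiction p ¬p

𝟙-no : {P : Set} (P? : Dec P) → ¬ P → 𝟙 P? ≡ 0
𝟙-no (yes p) ¬p = contradiction p ¬p
𝟙-no (no _)  ¬p = refl

𝟙-≤1 : {P : Set} (P? : Dec P) → 𝟙 P? ≤ 1
𝟙-≤1 (yes _) = ≤-refl
𝟙-≤1 (no _)  = z≤n

𝟙-mono : {P Q : Set} (P? : Dec P) (Q? : Dec Q) → (P → Q) → 𝟙 P? ≤ 𝟙 Q?
𝟙-mono (yes p) Q? imp = ≤-reflexive (sym (𝟙-yes Q? (imp p)))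
𝟙-mono (no _)  Q? imp = z≤n

∑-𝟙≡length-filter : {P : A → Set} (P? : Decidable P) (xs : List A) →
                    ∑ xs (λ x → 𝟙 (P? x)) ≡ length (filter P? xs)
∑-𝟙≡length-filter P? []       = refl
∑-𝟙≡length-filter P? (x ∷ xs) with P? x
... | yes _ = cong suc (∑-𝟙≡length-filter P? xs)
... | no  _ = ∑-𝟙≡length-filter P? xs

-- A cardinality bound tested on duplicate-free lists: the set need be neither enumerated nor
-- decidable, and the bound passes at once to subsets.
AtMost : ℕ → (A → Set) → Set
AtMost {A} n P = (xs : List A) → Unique xs → All P xs → length xs ≤ n

∑-𝟙-≤ : {P : A → Set} (P? : Decidable P) {n : ℕ} → AtMost n P →
        ∀ {xs} → Unique xs → ∑ xs (λ x → 𝟙 (P? x)) ≤ n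
∑-𝟙-≤ P? atMost {xs} unique =
  ≤-trans (≤-reflexive (∑-𝟙≡length-filter P? xs))
          (atMost (filter P? xs) (Unique.filter⁺ P? unique) (All.all-filter P? xs))

∑-δ : ∀ {v : ℕ} {vs} (g : ℕ → ℕ) → Unique vs → v ∈ vs → ∑ vs (λ u → 𝟙 (v ≟ u) * g u) ≡ g v
∑-δ {v} g (v∉ ∷ unique) (here {xs = vs} refl) =
  trans (cong₂ _+_ (trans (cong (_* g v) (𝟙-yes (v ≟ v) refl)) (+-identityʳ (g v))) (vanish v∉))
        (+-identityʳ (g v))
  where
  vanish : ∀ {us} → All (v ≢_) us → ∑ us (λ u → 𝟙 (v ≟ u) * g u) ≡ 0
  vanish []                   = refl
  vanish {u ∷ _} (v≢u ∷ rest) = cong₂ _+_ (cong (_* g u) (𝟙-no (v ≟ u) v≢u)) (vanish rest)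
∑-δ {v} g (_∷_ {x = u} u∉ unique) (there v∈vs) =
  cong₂ _+_ (cong (_* g u) (𝟙-no (v ≟ u) (λ v≡u → All.lookup u∉ v∈vs (sym v≡u)))) (∑-δ g unique v∈vs)

-- A Cauchy-Schwarz inequality for coincidences

2mn≤m²+n² : ∀ m n → 2 * (m * n) ≤ m * m + n * n
2mn≤m²+n² m n with ≤-total m n
... | inj₁ m≤n = subst (λ n → 2 * (m * n) ≤ m * m + n * n) (m+[n∸m]≡n m≤n) (sq m (n ∸ m))
  where
  expand : ∀ a b → a * a + (a + b) * (a + b) ≡ 2 * (a * (a + b)) + b * b
  expand = ℕ-Ring.solve-∀
  sq : ∀ a b → 2 * (a * (a + b)) ≤ a * a + (a + b) * (a + b)
  sq a b = subst (2 * (a * (a + b)) ≤_) (sym (expand a b)) (m≤m+n _ _)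
... | inj₂ n≤m = subst (λ m → 2 * (m * n) ≤ m * m + n * n) (m+[n∸m]≡n n≤m) (sq n (m ∸ n))
  where
  expand : ∀ a b → (a + b) * (a + b) + a * a ≡ 2 * ((a + b) * a) + b * b
  expand = ℕ-Ring.solve-∀
  sq : ∀ a b → 2 * ((a + b) * a) ≤ (a + b) * (a + b) + a * a
  sq a b = subst (2 * ((a + b) * a) ≤_) (sym (expand a b)) (m≤m+n _ _)

coincidences : List A → List B → (A → ℕ) → (B → ℕ) → ℕ
coincidences xs ys α β = ∑ xs (λ x → ∑ ys (λ y → 𝟙 (α x ≟ β y)))

module _ (m : ℕ) where

  private
    fibre : List A → (A → ℕ) → ℕ → ℕ
    fibre xs α v = ∑ xs (λ x → 𝟙 (α x ≟ v))

  -- Sorting the coincidences by their common value v turns the count into an inner product of two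
  -- vectors of fibre sizes.
  coincidences≡∑-fibres : (xs : List A) (ys : List B) (α : A → ℕ) (β : B → ℕ) → (∀ x → α x < m) →
    coincidences xs ys α β ≡ ∑ (upTo m) (λ v → fibre xs α v * fibre ys β v)
  coincidences≡∑-fibres xs ys α β α<m = begin
    ∑ xs (λ x → ∑ ys (λ y → 𝟙 (α x ≟ β y)))
      ≡⟨ ∑-cong xs (λ x → ∑-cong ys (λ y → trans (𝟙-sym (α x) (β y))
           (sym (∑-δ (λ v → 𝟙 (β y ≟ v)) (Unique.upTo⁺ m) (∈-upTo⁺ (α<m x)))))) ⟩
    ∑ xs (λ x → ∑ ys (λ y → ∑ (upTo m) (λ v → 𝟙 (α x ≟ v) * 𝟙 (β y ≟ v))))
      ≡⟨ ∑-cong xs (λ x → ∑-swap ys (upTo m) _) ⟩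
    ∑ xs (λ x → ∑ (upTo m) (λ v → ∑ ys (λ y → 𝟙 (α x ≟ v) * 𝟙 (β y ≟ v))))
      ≡⟨ ∑-swap xs (upTo m) _ ⟩
    ∑ (upTo m) (λ v → ∑ xs (λ x → ∑ ys (λ y → 𝟙 (α x ≟ v) * 𝟙 (β y ≟ v))))
      ≡⟨ ∑-cong (upTo m) (λ v → ∑-*-∑ xs ys _ _) ⟩
    ∑ (upTo m) (λ v → fibre xs α v * fibre ys β v) ∎
    where
    open ≡-Reasoning
    𝟙-sym : ∀ a b → 𝟙 (a ≟ b) ≡ 𝟙 (b ≟ a)
    𝟙-sym a b = ≤-antisym (𝟙-mono (a ≟ b) (b ≟ a) sym) (𝟙-mono (b ≟ a) (a ≟ b) sym)

  -- The inequality 2ab ≤ a² + b², applied to the fibre sizes at each value. This additive form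
  -- avoids square roots and suffices, since both terms on the right will be bounded by the same
  -- number.
  coincidences-cauchy-schwarz :
    (xs : List A) (ys : List B) (α : A → ℕ) (β : B → ℕ) → (∀ x → α x < m) → (∀ y → β y < m) →
    2 * coincidences xs ys α β ≤ coincidences xs xs α α + coincidences ys ys β β
  coincidences-cauchy-schwarz xs ys α β α<m β<m
    rewrite coincidences≡∑-fibres xs ys α β α<m
          | coincidences≡∑-fibres xs xs α α α<m
          | coincidences≡∑-fibres ys ys β β β<m
    = begin
    2 * ∑ (upTo m) (λ v → fibre xs α v * fibre ys β v)
      ≡⟨ sym (∑-*ˡ (upTo m) 2 _) ⟩
    ∑ (upTo m) (λ v → 2 * (fibre xs α v * fibre ys β v))
      ≤⟨ ∑-mono (upTo m) (λ v → 2mn≤m²+n² (fibre xs α v) (fibre ys β v)) ⟩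
    ∑ (upTo m) (λ v → fibre xs α v * fibre xs α v + fibre ys β v * fibre ys β v)
      ≡⟨ ∑-+ (upTo m) _ _ ⟩
    ∑ (upTo m) (λ v → fibre xs α v * fibre xs α v) + ∑ (upTo m) (λ v → fibre ys β v * fibre ys β v) ∎
    where open ≤-Reasoning

-- Additive energy modulo m

small-multiple≡0 : ∀ {m i} → abs i < m → pos m ∣ℤ i → i ≡ 0ℤ
small-multiple≡0 {m} {i} small m∣i with abs i ≟ 0
... | yes abs≡0 = ℤ.∣i∣≡0⇒i≡0 abs≡0
... | no  abs≢0 = contradiction (∣⇒≤ {{≢-nonZero abs≢0}} (∣⇒∣ᵤ m∣i)) (<⇒≱ small)

abs-pos-pos≤⊔ : ∀ a b → abs (pos a ℤ.- pos b) ≤ a ⊔ b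
abs-pos-pos≤⊔ a b = subst (_≤ a ⊔ b) (cong abs (sym (ℤ.m-n≡m⊖n a b))) (ℤ.∣m⊝n∣≤m⊔n a b)

abs-pos-pos< : ∀ {a b m} → a < m → b < m → abs (pos a ℤ.- pos b) < m
abs-pos-pos< {a} {b} a<m b<m = ≤-<-trans (abs-pos-pos≤⊔ a b) (⊔-lub a<m b<m)

interval-suc : ∀ n (g : ℕ → ℕ) → ∑ (interval (suc n)) g ≡ g 1 + ∑ (interval n) (g ∘ suc)
interval-suc n g = cong (g 1 +_) (begin
  ∑ (map suc (applyUpTo suc n)) g ≡⟨ ∑-map (applyUpTo suc n) suc g ⟩
  ∑ (applyUpTo suc n) (g ∘ suc)   ≡⟨ cong (λ xs → ∑ xs (g ∘ suc)) (sym (map-upTo suc n)) ⟩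
  ∑ (interval n) (g ∘ suc)        ∎)
  where open ≡-Reasoning

∑-interval-+ : ∀ a b (g : ℕ → ℕ) →
               ∑ (interval (a + b)) g ≡ ∑ (interval a) g + ∑ (interval b) (λ x → g (a + x))
∑-interval-+ zero    b g = refl
∑-interval-+ (suc a) b g = begin
  ∑ (interval (suc a + b)) g                     ≡⟨ interval-suc (a + b) g ⟩
  g 1 + ∑ (interval (a + b)) (g ∘ suc)           ≡⟨ cong (g 1 +_) (∑-interval-+ a b (g ∘ suc)) ⟩
  g 1 + (∑ (interval a) (g ∘ suc) + rest)        ≡⟨ sym (+-assoc (g 1) _ rest) ⟩
  g 1 + ∑ (interval a) (g ∘ suc) + rest          ≡⟨ cong (_+ rest) (sym (interval-suc a g)) ⟩
  ∑ (interval (suc a)) g + rest                  ∎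
  where
  open ≡-Reasoning
  rest = ∑ (interval b) (λ x → g (suc a + x))

∑-interval-* : ∀ k h (g : ℕ → ℕ) →
               ∑ (interval (k * h)) g ≡ ∑ (upTo k) (λ j → ∑ (interval h) (λ x → g (j * h + x)))
∑-interval-* zero    h g = refl
∑-interval-* (suc k) h g = begin
  ∑ (interval (h + k * h)) g
    ≡⟨ ∑-interval-+ h (k * h) g ⟩
  ∑ (interval h) g + ∑ (interval (k * h)) (λ x → g (h + x))
    ≡⟨ cong (∑ (interval h) g +_) (∑-interval-* k h _) ⟩
  ∑ (interval h) g + ∑ (upTo k) (λ j → ∑ (interval h) (λ x → g (h + (j * h + x))))
    ≡⟨ cong (∑ (interval h) g +_) (∑-cong (upTo k) (λ j → ∑-cong (interval h)
         (λ x → cong g (sym (+-assoc h (j * h) x))))) ⟩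
  ∑ (interval h) g + ∑ (upTo k) (block ∘ suc)
    ≡⟨ cong (∑ (interval h) g +_) (sym (∑-map (upTo k) suc block)) ⟩
  ∑ (interval h) g + ∑ (map suc (upTo k)) block
    ≡⟨ cong (λ js → ∑ (interval h) g + ∑ js block) (map-upTo suc k) ⟩
  ∑ (upTo (suc k)) block ∎
  where
  open ≡-Reasoning
  block : ℕ → ℕ
  block j = ∑ (interval h) (λ x → g (j * h + x))

∑-interval-mono : ∀ {H H′} → H ≤ H′ → ∀ g → ∑ (interval H) g ≤ ∑ (interval H′) g
∑-interval-mono {H} H≤H′ g =
  subst (λ n → ∑ (interval H) g ≤ ∑ (interval n) g) (m+[n∸m]≡n H≤H′)
        (subst (∑ (interval H) g ≤_) (sym (∑-interval-+ H _ g)) (m≤m+n _ _))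

interval-length : ∀ H → length (interval H) ≡ H
interval-length H = trans (length-map suc (upTo H)) (length-applyUpTo id H)

interval-unique : ∀ H → Unique (interval H)
interval-unique H = Unique.map⁺ suc-injective (Unique.upTo⁺ H)

∈-interval⁻ : ∀ {H x} → x ∈ interval H → 1 ≤ x × x ≤ H
∈-interval⁻ x∈ with y , y∈ , refl ← ∈-map⁻ suc x∈ = s≤s z≤n , ∈-upTo⁻ y∈

∈-interval⁺ : ∀ {H x} → 1 ≤ x → x ≤ H → x ∈ interval H
∈-interval⁺ {x = suc x} _ x≤H = ∈-map⁺ suc (∈-upTo⁺ x≤H)

_² : List A → List (A × A)
xs ² = cartesianProduct xs xs

∑-²-transpose : (xs : List A) (h : A → A → ℕ) →
                ∑ (xs ²) (λ p → h (proj₁ p) (proj₂ p)) ≡ ∑ (xs ²) (λ p → h (proj₂ p) (proj₁ p))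
∑-²-transpose xs h = trans (∑-× xs xs _) (trans (∑-swap xs xs h) (sym (∑-× xs xs _)))

∑-²-≤-const : (xs : List A) {g : A × A → ℕ} {c : ℕ} → (∀ p → g p ≤ c) →
              ∑ (xs ²) g ≤ length xs * (length xs * c)
∑-²-≤-const xs {g} g≤c = ≤-trans (≤-reflexive (∑-× xs xs g))
                             (∑-≤-const xs (λ {x} _ → ∑-≤-const xs (λ {y} _ → g≤c (x , y))))

∑-²² : (xs : List A) (h : A → A → A → A → ℕ) →
       ∑ (xs ²) (λ p → ∑ (xs ²) (λ q → h (proj₁ p) (proj₂ p) (proj₁ q) (proj₂ q)))
       ≡ ∑ xs (λ x → ∑ xs (λ y → ∑ xs (λ z → ∑ xs (λ w → h x y z w))))
∑-²² xs h = trans (∑-× xs xs _) (∑-cong xs (λ x → ∑-cong xs (λ y → ∑-× xs xs _)))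

∑-²²-exchange : (xs : List A) (h : A → A → A → A → ℕ) →
  ∑ (xs ²) (λ p → ∑ (xs ²) (λ q → h (proj₁ p) (proj₂ p) (proj₁ q) (proj₂ q)))
  ≡ ∑ (xs ²) (λ p → ∑ (xs ²) (λ q → h (proj₁ p) (proj₁ q) (proj₂ p) (proj₂ q)))
∑-²²-exchange xs h =
  trans (∑-²² xs h) (trans (∑-cong xs (λ x → ∑-swap xs xs _)) (sym (∑-²² xs (λ x y z w → h x z y w))))

module Energy (m : ℕ) .{{_ : NonZero m}} where

  residue-≡⇒∣ : ∀ i j → i %ℕ m ≡ j %ℕ m → pos m ∣ℤ i ℤ.- j
  residue-≡⇒∣ i j eq = Signed.divides (i /ℕ m ℤ.- j /ℕ m) (begin
    i ℤ.- j
      ≡⟨ cong₂ ℤ._-_ (a≡a%ℕn+[a/ℕn]*n i m) (a≡a%ℕn+[a/ℕn]*n j m) ⟩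
    (pos (i %ℕ m) ℤ.+ i /ℕ m ℤ.* pos m) ℤ.- (pos (j %ℕ m) ℤ.+ j /ℕ m ℤ.* pos m)
      ≡⟨ cong (λ r → (pos r ℤ.+ i /ℕ m ℤ.* pos m) ℤ.- (pos (j %ℕ m) ℤ.+ j /ℕ m ℤ.* pos m)) eq ⟩
    (pos (j %ℕ m) ℤ.+ i /ℕ m ℤ.* pos m) ℤ.- (pos (j %ℕ m) ℤ.+ j /ℕ m ℤ.* pos m)
      ≡⟨ cancel (pos (j %ℕ m)) (i /ℕ m) (j /ℕ m) (pos m) ⟩
    (i /ℕ m ℤ.- j /ℕ m) ℤ.* pos m ∎)
    where
    open ≡-Reasoning
    cancel : ∀ r a b c → (r ℤ.+ a ℤ.* c) ℤ.- (r ℤ.+ b ℤ.* c) ≡ (a ℤ.- b) ℤ.* c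
    cancel = ℤ-Ring.solve-∀

  ∣⇒residue-≡ : ∀ i j → pos m ∣ℤ i ℤ.- j → i %ℕ m ≡ j %ℕ m
  ∣⇒residue-≡ i j (Signed.divides k eq) = ℤ.+-injective (ℤ.i-j≡0⇒i≡j (pos (i %ℕ m)) (pos (j %ℕ m))
    (small-multiple≡0 (abs-pos-pos< (n%ℕd<d i m) (n%ℕd<d j m))
      (Signed.divides (k ℤ.- (i /ℕ m ℤ.- j /ℕ m)) (begin
        pos (i %ℕ m) ℤ.- pos (j %ℕ m)
          ≡⟨ regroup (pos (i %ℕ m)) (pos (j %ℕ m)) (i /ℕ m) (j /ℕ m) (pos m) ⟩
        ((pos (i %ℕ m) ℤ.+ i /ℕ m ℤ.* pos m) ℤ.- (pos (j %ℕ m) ℤ.+ j /ℕ m ℤ.* pos m))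
          ℤ.- (i /ℕ m ℤ.- j /ℕ m) ℤ.* pos m
          ≡⟨ cong (ℤ._- (i /ℕ m ℤ.- j /ℕ m) ℤ.* pos m)
               (trans (sym (cong₂ ℤ._-_ (a≡a%ℕn+[a/ℕn]*n i m) (a≡a%ℕn+[a/ℕn]*n j m))) eq) ⟩
        k ℤ.* pos m ℤ.- (i /ℕ m ℤ.- j /ℕ m) ℤ.* pos m
          ≡⟨ factor k (i /ℕ m ℤ.- j /ℕ m) (pos m) ⟩
        (k ℤ.- (i /ℕ m ℤ.- j /ℕ m)) ℤ.* pos m ∎))))
    where
    open ≡-Reasoning
    regroup : ∀ r s a b c →
              r ℤ.- s ≡ ((r ℤ.+ a ℤ.* c) ℤ.- (s ℤ.+ b ℤ.* c)) ℤ.- (a ℤ.- b) ℤ.* c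
    regroup = ℤ-Ring.solve-∀
    factor : ∀ a b c → a ℤ.* c ℤ.- b ℤ.* c ≡ (a ℤ.- b) ℤ.* c
    factor = ℤ-Ring.solve-∀

  -- Four functions instead of one, because the four variables of a solution may lie in four
  -- different blocks.
  energy : List ℕ → (f₁ f₂ f₃ f₄ : ℕ → ℤ) → ℕ
  energy I f₁ f₂ f₃ f₄ = ∑ (I ²) (λ p → ∑ (I ²) (λ q →
    𝟙 (pos m ∣ℤ? (f₁ (proj₁ p) ℤ.+ f₂ (proj₂ p)) ℤ.- (f₃ (proj₁ q) ℤ.+ f₄ (proj₂ q)))))

  private
    residues : {X : Set} → (X → ℤ) → X → ℕ
    residues φ x = φ x %ℕ m

    residues<m : {X : Set} (φ : X → ℤ) (x : X) → residues φ x < m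
    residues<m φ x = n%ℕd<d (φ x) m

    plus minus : (f g : ℕ → ℤ) → ℕ × ℕ → ℤ
    plus  f g p = f (proj₁ p) ℤ.+ g (proj₂ p)
    minus f g p = f (proj₁ p) ℤ.- g (proj₂ p)

    𝟙-residues : ∀ {k} i j → k ≡ i ℤ.- j → 𝟙 (pos m ∣ℤ? k) ≡ 𝟙 (i %ℕ m ≟ j %ℕ m)
    𝟙-residues i j refl = ≤-antisym (𝟙-mono (pos m ∣ℤ? _) (_ ≟ _) (∣⇒residue-≡ i j))
                                    (𝟙-mono (_ ≟ _) (pos m ∣ℤ? _) (residue-≡⇒∣ i j))

  energy≡coincidences-+ : ∀ I f₁ f₂ f₃ f₄ →
    energy I f₁ f₂ f₃ f₄ ≡ coincidences (I ²) (I ²) (residues (plus f₁ f₂)) (residues (plus f₃ f₄))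
  energy≡coincidences-+ I f₁ f₂ f₃ f₄ =
    ∑-cong (I ²) (λ p → ∑-cong (I ²) (λ q → 𝟙-residues (plus f₁ f₂ p) (plus f₃ f₄ q) refl))

  -- Rewriting f x + g y ≡ f z + g w as f x - f z ≡ g w - g y puts f and g on different sides, so
  -- that Cauchy-Schwarz compares with pure f and pure g.
  energy≡coincidences-− : ∀ I f g →
    energy I f g f g ≡ coincidences (I ²) (I ²) (residues (minus f f)) (residues (minus g g))
  energy≡coincidences-− I f g = begin
    energy I f g f g
      ≡⟨ ∑-²²-exchange I (λ x y z w → solves x y z w) ⟩
    ∑ (I ²) (λ p → ∑ (I ²) (λ q → solves (proj₁ p) (proj₁ q) (proj₂ p) (proj₂ q)))
      -- In g w - g y the variable w comes first, hence the exchange of y and w.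
      ≡⟨ ∑-cong (I ²) (λ p → ∑-²-transpose I (λ y w → solves (proj₁ p) y (proj₂ p) w)) ⟩
    ∑ (I ²) (λ p → ∑ (I ²) (λ q → solves (proj₁ p) (proj₂ q) (proj₂ p) (proj₁ q)))
      ≡⟨ ∑-cong (I ²) (λ p → ∑-cong (I ²) (λ q →
           𝟙-residues (minus f f p) (minus g g q)
             (regroup (f (proj₁ p)) (g (proj₂ q)) (f (proj₂ p)) (g (proj₁ q))))) ⟩
    coincidences (I ²) (I ²) (residues (minus f f)) (residues (minus g g)) ∎
    where
    open ≡-Reasoning
    solves : ℕ → ℕ → ℕ → ℕ → ℕ
    solves x y z w = 𝟙 (pos m ∣ℤ? (f x ℤ.+ g y) ℤ.- (f z ℤ.+ g w))
    regroup : ∀ a b c e → (a ℤ.+ b) ℤ.- (c ℤ.+ e) ≡ (a ℤ.- c) ℤ.- (e ℤ.- b)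
    regroup = ℤ-Ring.solve-∀

  private
    halve : ∀ {n a b B} → 2 * n ≤ a + b → a ≤ B → b ≤ B → n ≤ B
    halve {n} {a} {b} {B} 2n≤ a≤B b≤B =
      *-cancelˡ-≤ 2 (≤-trans 2n≤ (≤-trans (+-mono-≤ a≤B b≤B) (≤-reflexive (cong (B +_) (sym (+-identityʳ B))))))

  -- Cauchy-Schwarz twice: on sums it reduces the pattern (i,j,k,l) to (i,j,i,j) and (k,l,k,l), and
  -- on differences it reduces (i,j,i,j) to the pure energies of i and j.
  energy-mixed-≤ : ∀ I {B} (F : ℕ → ℕ → ℤ) → (∀ j → energy I (F j) (F j) (F j) (F j) ≤ B) →
                   ∀ i j k l → energy I (F i) (F j) (F k) (F l) ≤ B
  energy-mixed-≤ I {B} F diagonal i j k l = halve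
    (begin
      2 * energy I (F i) (F j) (F k) (F l)
        ≡⟨ cong (2 *_) (energy≡coincidences-+ I (F i) (F j) (F k) (F l)) ⟩
      2 * coincidences (I ²) (I ²) (residues (plus (F i) (F j))) (residues (plus (F k) (F l)))
        ≤⟨ coincidences-cauchy-schwarz m (I ²) (I ²) _ _ 
             (residues<m (plus (F i) (F j))) (residues<m (plus (F k) (F l))) ⟩
      coincidences (I ²) (I ²) (residues (plus (F i) (F j))) (residues (plus (F i) (F j)))
        + coincidences (I ²) (I ²) (residues (plus (F k) (F l))) (residues (plus (F k) (F l)))
        ≡⟨ sym (cong₂ _+_ (energy≡coincidences-+ I (F i) (F j) (F i) (F j))
                          (energy≡coincidences-+ I (F k) (F l) (F k) (F l))) ⟩
      energy I (F i) (F j) (F i) (F j) + energy I (F k) (F l) (F k) (F l) ∎)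
    (two i j) (two k l)
    where
    open ≤-Reasoning
    two : ∀ i j → energy I (F i) (F j) (F i) (F j) ≤ B
    two i j = halve
      (begin
        2 * energy I (F i) (F j) (F i) (F j)
          ≡⟨ cong (2 *_) (energy≡coincidences-− I (F i) (F j)) ⟩
        2 * coincidences (I ²) (I ²) (residues (minus (F i) (F i))) (residues (minus (F j) (F j)))
          ≤⟨ coincidences-cauchy-schwarz m (I ²) (I ²) _ _ 
               (residues<m (minus (F i) (F i))) (residues<m (minus (F j) (F j))) ⟩
        coincidences (I ²) (I ²) (residues (minus (F i) (F i))) (residues (minus (F i) (F i)))
          + coincidences (I ²) (I ²) (residues (minus (F j) (F j))) (residues (minus (F j) (F j)))
          ≡⟨ sym (cong₂ _+_ (energy≡coincidences-− I (F i) (F i)) (energy≡coincidences-− I (F j) (F j))) ⟩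
        energy I (F i) (F i) (F i) (F i) + energy I (F j) (F j) (F j) (F j) ∎)
      (diagonal i) (diagonal j)

  ∑-interval²-blocks : ∀ k h (g : ℕ × ℕ → ℕ) →
    ∑ (interval (k * h) ²) g
    ≡ ∑ (upTo k ²) (λ b → ∑ (interval h ²) (λ p → g (proj₁ b * h + proj₁ p , proj₂ b * h + proj₂ p)))
  ∑-interval²-blocks k h g = begin
    ∑ (interval (k * h) ²) g
      ≡⟨ ∑-× (interval (k * h)) (interval (k * h)) g ⟩
    ∑ (interval (k * h)) (λ X → ∑ (interval (k * h)) (λ Y → g (X , Y)))
      ≡⟨ ∑-interval-* k h _ ⟩
    ∑ (upTo k) (λ i → ∑ (interval h) (λ x → ∑ (interval (k * h)) (λ Y → g (i * h + x , Y))))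
      ≡⟨ ∑-cong (upTo k) (λ i → ∑-cong (interval h) (λ x → ∑-interval-* k h _)) ⟩
    ∑ (upTo k) (λ i → ∑ (interval h) (λ x → ∑ (upTo k) (λ j → ∑ (interval h) (λ y →
      g (i * h + x , j * h + y)))))
      ≡⟨ ∑-cong (upTo k) (λ i → ∑-swap (interval h) (upTo k) _) ⟩
    ∑ (upTo k) (λ i → ∑ (upTo k) (λ j → ∑ (interval h) (λ x → ∑ (interval h) (λ y →
      g (i * h + x , j * h + y)))))
      ≡⟨ ∑-cong (upTo k) (λ i → ∑-cong (upTo k) (λ j → sym (∑-× (interval h) (interval h) _))) ⟩
    ∑ (upTo k) (λ i → ∑ (upTo k) (λ j → ∑ (interval h ²) (λ p →
      g (i * h + proj₁ p , j * h + proj₂ p))))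
      ≡⟨ sym (∑-× (upTo k) (upTo k) _) ⟩
    ∑ (upTo k ²) (λ b → ∑ (interval h ²) (λ p → g (proj₁ b * h + proj₁ p , proj₂ b * h + proj₂ p))) ∎
    where open ≡-Reasoning

  energy-blocks : ∀ k h f {B} →
    (∀ s → energy (interval h) (λ x → f (s + x)) (λ x → f (s + x)) (λ x → f (s + x)) (λ x → f (s + x)) ≤ B) →
    energy (interval (k * h)) f f f f ≤ k * k * (k * k * B)
  energy-blocks k h f {B} block≤B = begin
    energy (interval (k * h)) f f f f
      ≡⟨ ∑-interval²-blocks k h _ ⟩
    ∑ (upTo k ²) (λ b → ∑ (interval h ²) (λ p → ∑ (interval (k * h) ²) (λ Q → _)))
      ≡⟨ ∑-cong (upTo k ²) (λ b → ∑-cong (interval h ²) (λ p → ∑-interval²-blocks k h _)) ⟩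
    ∑ (upTo k ²) (λ b → ∑ (interval h ²) (λ p → ∑ (upTo k ²) (λ c → ∑ (interval h ²) (λ q → _))))
      ≡⟨ ∑-cong (upTo k ²) (λ b → ∑-swap (interval h ²) (upTo k ²) _) ⟩
    ∑ (upTo k ²) (λ b → ∑ (upTo k ²) (λ c →
      energy (interval h) (F (proj₁ b)) (F (proj₂ b)) (F (proj₁ c)) (F (proj₂ c))))
      ≤⟨ ∑-²-≤-const (upTo k) (λ b → ∑-²-≤-const (upTo k) (λ c →
           energy-mixed-≤ (interval h) F (λ j → block≤B (j * h)) (proj₁ b) (proj₂ b) (proj₁ c) (proj₂ c))) ⟩
    length (upTo k) * (length (upTo k) * (length (upTo k) * (length (upTo k) * B)))
      ≡⟨ cong (λ n → n * (n * (n * (n * B)))) (length-applyUpTo id k) ⟩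
    k * (k * (k * (k * B)))
      ≡⟨ regroup k B ⟩
    k * k * (k * k * B) ∎
    where
    open ≤-Reasoning
    F : ℕ → ℕ → ℤ
    F j x = f (j * h + x)
    regroup : ∀ k B → k * (k * (k * (k * B))) ≡ k * k * (k * k * B)
    regroup = ℕ-Ring.solve-∀

  -- Allows the length to be rounded up to a multiple of the block length.
  energy-interval-mono : ∀ {H H′} → H ≤ H′ → ∀ f →
                         energy (interval H) f f f f ≤ energy (interval H′) f f f f
  energy-interval-mono {H} {H′} H≤H′ f = begin
    energy (interval H) f f f f
      ≡⟨ ∑-²² (interval H) solves ⟩
    ∑ (interval H) (λ x → ∑ (interval H) (λ y → ∑ (interval H) (λ z → ∑ (interval H) (λ w → solves x y z w))))
      ≤⟨ widen (λ x → widen (λ y → widen (λ z → widen (λ w → ≤-refl)))) ⟩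
    ∑ (interval H′) (λ x → ∑ (interval H′) (λ y → ∑ (interval H′) (λ z → ∑ (interval H′) (λ w → solves x y z w))))
      ≡⟨ sym (∑-²² (interval H′) solves) ⟩
    energy (interval H′) f f f f ∎
    where
    open ≤-Reasoning
    solves : ℕ → ℕ → ℕ → ℕ → ℕ
    solves x y z w = 𝟙 (pos m ∣ℤ? (f x ℤ.+ f y) ℤ.- (f z ℤ.+ f w))
    widen : ∀ {g g′} → (∀ x → g x ≤ g′ x) → ∑ (interval H) g ≤ ∑ (interval H′) g′
    widen g≤g′ = ≤-trans (∑-mono (interval H) g≤g′) (∑-interval-mono H≤H′ _)

  T≤energy : ∀ d a H f → (∀ x → f x ≡ pos (evalPoly d a x)) → T m d a H ≤ energy (interval H) f f f f
  T≤energy d a H f f≡ = ≤-trans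
    (∑-mono I (λ x → ∑-mono I (λ y → ∑-mono I (λ z → ∑-mono I (λ w → counted x y z w)))))
    (≤-reflexive (sym (∑-²² I λ x y z w → solves x y z w)))
    where
    I = interval H
    solves : ℕ → ℕ → ℕ → ℕ → ℕ
    solves x y z w = 𝟙 (pos m ∣ℤ? (f x ℤ.+ f y) ℤ.- (f z ℤ.+ f w))
    counted : ∀ x y z w →
      (if ((evalPoly d a x + evalPoly d a y) % m) ≡ᵇ ((evalPoly d a z + evalPoly d a w) % m) then 1 else 0)
      ≤ solves x y z w
    counted x y z w
      with ((evalPoly d a x + evalPoly d a y) % m) ≡ᵇ ((evalPoly d a z + evalPoly d a w) % m)
         | ≡ᵇ⇒≡ ((evalPoly d a x + evalPoly d a y) % m) ((evalPoly d a z + evalPoly d a w) % m)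
    ... | false | _  = z≤n
    ... | true  | eq = ≤-reflexive (sym (𝟙-yes (pos m ∣ℤ? _)
          (subst (pos m ∣ℤ_) (sym (cong₂ ℤ._-_ (cong₂ ℤ._+_ (f≡ x) (f≡ y)) (cong₂ ℤ._+_ (f≡ z) (f≡ w))))
            (residue-≡⇒∣ (pos (evalPoly d a x + evalPoly d a y)) (pos (evalPoly d a z + evalPoly d a w)) (eq _)))))

-- The divisor bound

AtMost-split : {P Q : A → Set} (Q? : Decidable Q) {s t : ℕ} →
               AtMost s (λ x → P x × Q x) → AtMost t (λ x → P x × ¬ Q x) → AtMost (s + t) P
AtMost-split {P = P} {Q} Q? {s} {t} atMost-Q atMost-¬Q xs unique all-P = begin
  length xs
    ≡⟨ split xs ⟩
  length (filter Q? xs) + length (filter (¬? ∘ Q?) xs)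
    ≤⟨ +-mono-≤
         (atMost-Q _ (Unique.filter⁺ Q? unique)
           (All.zip (All.filter⁺ Q? all-P , All.all-filter Q? xs)))
         (atMost-¬Q _ (Unique.filter⁺ (¬? ∘ Q?) unique)
           (All.zip (All.filter⁺ (¬? ∘ Q?) all-P , All.all-filter (¬? ∘ Q?) xs))) ⟩
  s + t ∎
  where
  open ≤-Reasoning
  split : ∀ xs → length xs ≡ length (filter Q? xs) + length (filter (¬? ∘ Q?) xs)
  split []       = refl
  split (x ∷ xs) with Q? x
  ... | yes _ = cong suc (split xs)
  ... | no  _ = trans (cong suc (split xs)) (sym (+-suc _ _))

AtMost-image : {P : A → Set} {Q : B → Set} (φ : A → B) → (∀ {y} → Q y → ∃ λ x → P x × φ x ≡ y) →
               ∀ {t} → AtMost t P → AtMost t Q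
AtMost-image {P = P} {Q} φ preimage {t} atMost ys unique all-Q =
  bound unique (preimages all-Q)
  where
  preimages : ∀ {ys} → All Q ys → ∃ λ xs → map φ xs ≡ ys × All P xs
  preimages []       = [] , refl , []
  preimages (q ∷ qs) with preimage q | preimages qs
  ... | x , p , refl | xs , refl , ps = x ∷ xs , refl , p ∷ ps
  bound : ∀ {ys} → Unique ys → (∃ λ xs → map φ xs ≡ ys × All P xs) → length ys ≤ t
  bound unique (xs , refl , all-P) =
    subst (_≤ t) (sym (length-map φ xs)) (atMost xs (Unique.map⁻ unique) all-P)

prime-∤⇒coprime : ∀ {p e} → Prime p → ¬ p ∣ e → Coprime e p
prime-∤⇒coprime pr p∤e (i∣e , i∣p) with prime⇒irreducible pr i∣p
... | inj₁ i≡1  = i≡1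
... | inj₂ refl = contradiction i∣e p∤e

-- A divisor that is a multiple of p is p times a divisor of p^(a-1) r, and any other one is coprime
-- to p and divides r. Each power of p thus adds at most t divisors.
divisors-prime-power-* : ∀ {p r t} → Prime p → AtMost t (_∣ r) → ∀ a → AtMost (suc a * t) (_∣ p ^ a * r)
divisors-prime-power-* {p} {r} {t} pr atMost zero =
  subst₂ (λ t r → AtMost t (_∣ r)) (sym (*-identityˡ t)) (sym (*-identityˡ r)) atMost
divisors-prime-power-* {p} {r} {t} pr atMost (suc a) =
  subst (λ s → AtMost s (_∣ p ^ suc a * r)) (+-comm (suc a * t) t)
    (AtMost-split (p ∣?_)
      (AtMost-image (p *_) divide (divisors-prime-power-* pr atMost a))
      (λ xs unique all → atMost xs unique (All.map (λ (e∣ , p∤e) → strip (prime-∤⇒coprime pr p∤e) (suc a) e∣) all)))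
  where
  strip : ∀ {e} → Coprime e p → ∀ a → e ∣ p ^ a * r → e ∣ r
  strip     coprime zero    e∣ = subst (_ ∣_) (*-identityˡ r) e∣
  strip {e} coprime (suc a) e∣ =
    strip coprime a (coprime-divisor coprime (subst (e ∣_) (*-assoc p (p ^ a) r) e∣))
  divide : ∀ {e} → e ∣ p ^ suc a * r × p ∣ e → ∃ λ e′ → e′ ∣ p ^ a * r × p * e′ ≡ e
  divide (e∣ , divides q refl) =
    q , *-cancelˡ-∣ p {{prime⇒nonZero pr}} (subst₂ _∣_ (*-comm q p) (*-assoc p (p ^ a) r) e∣) , *-comm p q

^-distribʳ-* : ∀ k m n → (m * n) ^ k ≡ m ^ k * n ^ k
^-distribʳ-* zero    m n = refl
^-distribʳ-* (suc k) m n = trans (cong (m * n *_) (^-distribʳ-* k m n)) (regroup m n (m ^ k) (n ^ k))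
  where
  regroup : ∀ a b c d → a * b * (c * d) ≡ a * c * (b * d)
  regroup = ℕ-Ring.solve-∀

n<2^n : ∀ n → n < 2 ^ n
n<2^n zero    = s≤s z≤n
n<2^n (suc n) = begin-strict
  suc n             ≤⟨ n<2^n n ⟩
  2 ^ n             <⟨ m<m+n (2 ^ n) (≤-trans (m^n>0 2 n) (m≤m+n _ 0)) ⟩
  2 ^ n + (2 ^ n + 0) ∎
  where open ≤-Reasoning

-- The exact power p^a multiplies the number of divisors by at most a + 1; its k-th power is paid
-- for by 2^a ≤ p^a up to the factor k^k. With q the quotient of a by k, a + 1 ≤ k(q + 1) ≤ k 2^q.
[1+a]^k≤k^k*2^a : ∀ k .{{_ : NonZero k}} a → suc a ^ k ≤ k ^ k * 2 ^ a
[1+a]^k≤k^k*2^a k a = begin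
  suc a ^ k                ≤⟨ ^-monoˡ-≤ k 1+a≤ ⟩
  (k * 2 ^ q) ^ k          ≡⟨ ^-distribʳ-* k k (2 ^ q) ⟩
  k ^ k * (2 ^ q) ^ k      ≡⟨ cong (k ^ k *_) (^-*-assoc 2 q k) ⟩
  k ^ k * 2 ^ (q * k)      ≤⟨ *-monoʳ-≤ (k ^ k) (^-monoʳ-≤ 2 (≤-trans (m≤n+m (q * k) (a % k)) (≤-reflexive (sym a≡)))) ⟩
  k ^ k * 2 ^ a ∎
  where
  open ≤-Reasoning
  q = a / k
  a≡ : a ≡ a % k + q * k
  a≡ = m≡m%n+[m/n]*n a k
  1+a≤ : suc a ≤ k * 2 ^ q
  1+a≤ = begin
    suc a              ≡⟨ cong suc a≡ ⟩
    suc (a % k) + q * k ≤⟨ +-monoˡ-≤ (q * k) (m%n<n a k) ⟩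
    suc q * k          ≤⟨ *-monoˡ-≤ k (n<2^n q) ⟩
    2 ^ q * k          ≡⟨ *-comm (2 ^ q) k ⟩
    k * 2 ^ q          ∎

strip-factor : ∀ b → 2 ≤ b → ∀ n .{{_ : NonZero n}} → ∃ λ a → ∃ λ r → n ≡ b ^ a * r × ¬ b ∣ r
strip-factor b 2≤b n = go n n ≤-refl
  where
  go : ∀ fuel n .{{_ : NonZero n}} → n ≤ fuel → ∃ λ a → ∃ λ r → n ≡ b ^ a * r × ¬ b ∣ r
  go zero       (suc n) ()
  go (suc fuel) n@(suc _) n≤ with b ∣? n
  ... | no  b∤n = 0 , n , sym (*-identityˡ n) , b∤n
  ... | yes (divides q@(suc _) n≡q*b)
    with a , r , q≡ , b∤r ← go fuel q (≤-pred (≤-trans (subst (q <_) (sym n≡q*b) (m<m*n q b 2≤b)) n≤)) =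
    suc a , r , trans n≡q*b (trans (*-comm q b) (trans (cong (b *_) q≡) (sym (*-assoc b (b ^ a) r)))) , b∤r

module _ (k : ℕ) .{{_ : NonZero k}} where

  -- Each further prime at most doubles the number of divisors. The resulting factor 2^k in the k-th
  -- power is covered by the prime itself, so large primes cost no constant.
  divisors-product-of-large-primes : ∀ {ps} → All Prime ps → All (2 ^ k ≤_) ps →
    ∃ λ t → AtMost t (_∣ product ps) × t ^ k ≤ product ps
  divisors-product-of-large-primes [] [] = 1 , divisors-of-1 , ≤-reflexive (^-zeroˡ k)
    where
    divisors-of-1 : AtMost 1 (_∣ 1)
    divisors-of-1 []          _                 _                 = z≤n
    divisors-of-1 (_ ∷ [])    _                 _                 = s≤s z≤n
    divisors-of-1 (x ∷ y ∷ _) ((x≢y ∷ _) ∷ _) (x∣1 ∷ y∣1 ∷ _) =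
      contradiction (trans (∣1⇒≡1 x∣1) (sym (∣1⇒≡1 y∣1))) x≢y
  divisors-product-of-large-primes {p ∷ ps} (pr ∷ prs) (2^k≤p ∷ large)
    with t , atMost , t^k≤ ← divisors-product-of-large-primes prs large =
    2 * t ,
    subst (λ n → AtMost (2 * t) (_∣ n * product ps)) (^-identityʳ p) (divisors-prime-power-* pr atMost 1) ,
    (begin
      (2 * t) ^ k     ≡⟨ ^-distribʳ-* k 2 t ⟩
      2 ^ k * t ^ k   ≤⟨ *-mono-≤ 2^k≤p t^k≤ ⟩
      p * product ps  ∎)
    where open ≤-Reasoning

  -- The primes below 2^k are removed one after another, each at the price of a factor k^k.
  divisors-rough : ∀ g {b n} .{{_ : NonZero n}} → b + g ≡ 2 ^ k → 2 ≤ b → b Rough n →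
                   ∃ λ t → AtMost t (_∣ n) × t ^ k ≤ (k ^ k) ^ g * n
  divisors-rough zero {b} {n} b≡ 2≤b rough = from-primes (divisors-product-of-large-primes factorsPrime large)
    where
    open PrimeFactorisation (factorise n)
    large : All (2 ^ k ≤_) factors
    large = All.tabulate λ {p} p∈ → subst (_≤ p) (trans (sym (+-identityʳ b)) b≡)
      (rough⇒≤ {{prime⇒nonTrivial (All.lookup factorsPrime p∈)}}
        (rough∧∣⇒rough rough (subst (p ∣_) (sym isFactorisation) (∈⇒∣product p∈))))
    from-primes : (∃ λ t → AtMost t (_∣ product factors) × t ^ k ≤ product factors) →
                  ∃ λ t → AtMost t (_∣ n) × t ^ k ≤ 1 * n
    from-primes (t , atMost , t^k≤) =
      t , subst (λ n → AtMost t (_∣ n)) (sym isFactorisation) atMost ,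
      ≤-trans t^k≤ (≤-reflexive (trans (sym isFactorisation) (sym (*-identityˡ n))))
  divisors-rough (suc g) {b} {n} b+g≡ 2≤b rough with b ∣? n
  ... | no b∤n
    with t , atMost , t^k≤ ← divisors-rough g {suc b} (trans (sym (+-suc b g)) b+g≡) (m≤n⇒m≤1+n 2≤b)
                                                  (∤⇒rough-suc b∤n rough) =
    t , atMost , ≤-trans t^k≤ (*-monoˡ-≤ n (m≤n*m ((k ^ k) ^ g) (k ^ k) {{m^n≢0 k k}}))
  -- A divisor b of a b-rough number is prime, so the search may run through all integers b.
  ... | yes b∣n
    with strip-factor b 2≤b n
  ... | a , r , refl , b∤r
    with t , atMost , t^k≤ ← divisors-rough g {suc b} {r} {{m*n≢0⇒n≢0 (b ^ a)}} (trans (sym (+-suc b g)) b+g≡)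
                               (m≤n⇒m≤1+n 2≤b) (∤⇒rough-suc b∤r (rough∧∣⇒rough rough (n∣m*n (b ^ a)))) =
    suc a * t ,
    divisors-prime-power-* (rough∧∣⇒prime {{n>1⇒nonTrivial 2≤b}} rough b∣n) atMost a ,
    (begin
      (suc a * t) ^ k                              ≡⟨ ^-distribʳ-* k (suc a) t ⟩
      suc a ^ k * t ^ k                            ≤⟨ *-mono-≤ ([1+a]^k≤k^k*2^a k a) t^k≤ ⟩
      (k ^ k * 2 ^ a) * ((k ^ k) ^ g * r)          ≤⟨ *-monoˡ-≤ _ (*-monoʳ-≤ (k ^ k) (^-monoˡ-≤ a 2≤b)) ⟩
      (k ^ k * b ^ a) * ((k ^ k) ^ g * r)          ≡⟨ regroup (k ^ k) (b ^ a) ((k ^ k) ^ g) r ⟩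
      (k ^ k) ^ suc g * (b ^ a * r)                ∎)
    where
    open ≤-Reasoning
    regroup : ∀ c b d r → (c * b) * (d * r) ≡ (c * d) * (b * r)
    regroup = ℕ-Ring.solve-∀

  -- The bound τ(n) = O(n^ε) with ε = 1/k. The exponent 2^k - 2 counts the candidates b with 2 ≤ b <
  -- 2^k.
  divisor-bound : ∃ λ C → ∀ n .{{_ : NonZero n}} → ∃ λ t → AtMost t (_∣ n) × t ^ k ≤ C * n
  divisor-bound = (k ^ k) ^ (2 ^ k ∸ 2) , λ n →
    divisors-rough (2 ^ k ∸ 2) (m+[n∸m]≡n (^-monoʳ-≤ 2 (>-nonZero⁻¹ k))) ≤-refl 2-rough

-- Integer polynomials as functions

-- HasLead n c p: the function p is a polynomial of formal degree n with n-th coefficient c (possibly 0).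
HasLead : ℕ → ℤ → (ℤ → ℤ) → Set
HasLead zero    c p = ∀ x → p x ≡ c
HasLead (suc n) c p = Σ ℤ λ a → Σ (ℤ → ℤ) λ q → HasLead n c q × (∀ x → p x ≡ a ℤ.+ x ℤ.* q x)

private
  variable
    n : ℕ
    c e : ℤ
    p q : ℤ → ℤ

HasLead-≗ : (∀ x → q x ≡ p x) → HasLead n c p → HasLead n c q
HasLead-≗ {n = zero}  q≗p p-const            = λ x → trans (q≗p x) (p-const x)
HasLead-≗ {n = suc n} q≗p (a , r , lead , eq) = a , r , lead , λ x → trans (q≗p x) (eq x)

HasLead-+ : HasLead n c p → HasLead n e q → HasLead n (c ℤ.+ e) (λ x → p x ℤ.+ q x)
HasLead-+ {n = zero}  p-const q-const = λ x → cong₂ ℤ._+_ (p-const x) (q-const x)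
HasLead-+ {n = suc n} (a , p′ , lead-p , p≡) (b , q′ , lead-q , q≡) =
  a ℤ.+ b , _ , HasLead-+ {n = n} lead-p lead-q ,
  λ x → trans (cong₂ ℤ._+_ (p≡ x) (q≡ x)) (regroup a b x (p′ x) (q′ x))
  where
  regroup : ∀ a b x s t → (a ℤ.+ x ℤ.* s) ℤ.+ (b ℤ.+ x ℤ.* t) ≡ (a ℤ.+ b) ℤ.+ x ℤ.* (s ℤ.+ t)
  regroup = ℤ-Ring.solve-∀

HasLead-* : ∀ k → HasLead n c p → HasLead n (k ℤ.* c) (λ x → k ℤ.* p x)
HasLead-* {n = zero}  k p-const = λ x → cong (k ℤ.*_) (p-const x)
HasLead-* {n = suc n} k (a , q , lead , p≡) =
  k ℤ.* a , _ , HasLead-* {n = n} k lead , λ x → trans (cong (k ℤ.*_) (p≡ x)) (regroup k a x (q x))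
  where
  regroup : ∀ k a x s → k ℤ.* (a ℤ.+ x ℤ.* s) ≡ k ℤ.* a ℤ.+ x ℤ.* (k ℤ.* s)
  regroup = ℤ-Ring.solve-∀

HasLead-x* : HasLead n c p → HasLead (suc n) c (λ x → x ℤ.* p x)
HasLead-x* lead = 0ℤ , _ , lead , λ x → sym (ℤ.+-identityˡ _)

HasLead-lift : HasLead n c p → HasLead (suc n) 0ℤ p
HasLead-lift {n = zero}  {c} p-const = c , _ , (λ _ → refl) ,
  λ x → trans (p-const x) (trans (sym (ℤ.+-identityʳ c)) (cong (λ s → c ℤ.+ s) (sym (ℤ.*-zeroʳ x))))
HasLead-lift {n = suc n} (a , q , lead , p≡) = a , q , HasLead-lift {n = n} lead , p≡

HasLead-+-lower : HasLead (suc n) c p → HasLead n e q → HasLead (suc n) c (λ x → p x ℤ.+ q x)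
HasLead-+-lower {n} {c} {p} {e} {q} lead-p lead-q =
  subst (λ c → HasLead (suc n) c (λ x → p x ℤ.+ q x)) (ℤ.+-identityʳ c)
        (HasLead-+ {n = suc n} {p = p} {q = q} lead-p (HasLead-lift {n = n} lead-q))

HasLead-shift : ∀ r → HasLead n c p → HasLead n c (λ x → p (x ℤ.+ r))
HasLead-shift {n = zero}  r p-const = λ x → p-const (x ℤ.+ r)
HasLead-shift {n = suc n} {c} r (a , q , lead , p≡) with HasLead-shift {n = n} r lead
... | lead′ = HasLead-≗ {n = suc n}
  (λ x → trans (p≡ (x ℤ.+ r)) (regroup a x r (q (x ℤ.+ r))))
  (HasLead-+-lower {n = n} (a , _ , lead′ , λ x → refl) (HasLead-* {n = n} r lead′))
  where
  regroup : ∀ a x r s → a ℤ.+ (x ℤ.+ r) ℤ.* s ≡ (a ℤ.+ x ℤ.* s) ℤ.+ r ℤ.* s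
  regroup = ℤ-Ring.solve-∀

-- For p = a + x q, the difference is x (q(x+r) - q(x)) + r q(x+r). By induction the first summand
-- contributes n r c and the second r c, where n is the formal degree of q.
HasLead-Δ : ∀ r → HasLead (suc n) c p → HasLead n (pos (suc n) ℤ.* (r ℤ.* c)) (λ x → p (x ℤ.+ r) ℤ.- p x)
HasLead-Δ {n = zero} {c} r (a , q , q-const , p≡) = λ x → begin
  _ ≡⟨ cong₂ ℤ._-_ (p≡ (x ℤ.+ r)) (p≡ x) ⟩
  (a ℤ.+ (x ℤ.+ r) ℤ.* q (x ℤ.+ r)) ℤ.- (a ℤ.+ x ℤ.* q x)
    ≡⟨ cong₂ (λ s t → (a ℤ.+ (x ℤ.+ r) ℤ.* s) ℤ.- (a ℤ.+ x ℤ.* t)) (q-const (x ℤ.+ r)) (q-const x) ⟩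
  (a ℤ.+ (x ℤ.+ r) ℤ.* c) ℤ.- (a ℤ.+ x ℤ.* c)
    ≡⟨ simplify a x r c ⟩
  pos 1 ℤ.* (r ℤ.* c) ∎
  where
  open ≡-Reasoning
  simplify : ∀ a x r c → (a ℤ.+ (x ℤ.+ r) ℤ.* c) ℤ.- (a ℤ.+ x ℤ.* c) ≡ pos 1 ℤ.* (r ℤ.* c)
  simplify = ℤ-Ring.solve-∀
HasLead-Δ {n = suc n} {c} r (a , q , lead , p≡) =
  subst (λ e → HasLead (suc n) e _) lead≡
    (HasLead-≗ {n = suc n} Δ≡
      (HasLead-+ {n = suc n} (HasLead-x* {n = n} (HasLead-Δ {n = n} r lead))
                             (HasLead-* {n = suc n} r (HasLead-shift {n = suc n} r lead))))
  where
  Δ≡ : ∀ x → _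
  Δ≡ x = trans (cong₂ ℤ._-_ (p≡ (x ℤ.+ r)) (p≡ x)) (regroup a x r (q (x ℤ.+ r)) (q x))
    where
    regroup : ∀ a x r s t → (a ℤ.+ (x ℤ.+ r) ℤ.* s) ℤ.- (a ℤ.+ x ℤ.* t) ≡ x ℤ.* (s ℤ.- t) ℤ.+ r ℤ.* s
    regroup = ℤ-Ring.solve-∀
  lead≡ : pos (suc n) ℤ.* (r ℤ.* c) ℤ.+ r ℤ.* c ≡ pos (suc (suc n)) ℤ.* (r ℤ.* c)
  lead≡ = add-one (pos (suc n)) (r ℤ.* c)
    where
    add-one : ∀ k s → k ℤ.* s ℤ.+ s ≡ (pos 1 ℤ.+ k) ℤ.* s
    add-one = ℤ-Ring.solve-∀

-- For p = a + x q, p(x) - p(y) = (x - y) q(x) + y (q(x) - q(y)), and induction splits x - y off the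
-- last bracket. Used for counting roots and for the divisibility of f x - f z by x - z.
HasLead-quotient : HasLead (suc n) c p → ∀ y →
                   ∃ λ q → HasLead n c q × (∀ x → p x ℤ.- p y ≡ (x ℤ.- y) ℤ.* q x)
HasLead-quotient {n = zero} {c} (a , q , q-const , p≡) y = q , q-const , λ x →
  trans (cong₂ ℤ._-_ (p≡ x) (p≡ y))
    (trans (cong (λ s → (a ℤ.+ x ℤ.* q x) ℤ.- (a ℤ.+ y ℤ.* s)) (trans (q-const y) (sym (q-const x))))
      (factor a x y (q x)))
  where
  factor : ∀ a x y s → (a ℤ.+ x ℤ.* s) ℤ.- (a ℤ.+ y ℤ.* s) ≡ (x ℤ.- y) ℤ.* s
  factor = ℤ-Ring.solve-∀
HasLead-quotient {n = suc n} {c} (a , q , lead , p≡) y with HasLead-quotient {n = n} lead y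
... | w , lead-w , q-q≡ = _ , HasLead-+-lower {n = n} lead (HasLead-* {n = n} y lead-w) , λ x → begin
  _ ≡⟨ cong₂ ℤ._-_ (p≡ x) (p≡ y) ⟩
  (a ℤ.+ x ℤ.* q x) ℤ.- (a ℤ.+ y ℤ.* q y)
    ≡⟨ split a x y (q x) (q y) ⟩
  (x ℤ.- y) ℤ.* q x ℤ.+ y ℤ.* (q x ℤ.- q y)
    ≡⟨ cong (λ s → (x ℤ.- y) ℤ.* q x ℤ.+ y ℤ.* s) (q-q≡ x) ⟩
  (x ℤ.- y) ℤ.* q x ℤ.+ y ℤ.* ((x ℤ.- y) ℤ.* w x)
    ≡⟨ factor (x ℤ.- y) y (q x) (w x) ⟩
  (x ℤ.- y) ℤ.* (q x ℤ.+ y ℤ.* w x) ∎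
  where
  open ≡-Reasoning
  split : ∀ a x y s t → (a ℤ.+ x ℤ.* s) ℤ.- (a ℤ.+ y ℤ.* t) ≡ (x ℤ.- y) ℤ.* s ℤ.+ y ℤ.* (s ℤ.- t)
  split = ℤ-Ring.solve-∀
  factor : ∀ u y s t → u ℤ.* s ℤ.+ y ℤ.* (u ℤ.* t) ≡ u ℤ.* (s ℤ.+ y ℤ.* t)
  factor = ℤ-Ring.solve-∀

AtMost-roots : HasLead n c p → c ≢ 0ℤ → AtMost n (λ x → p x ≡ 0ℤ)
AtMost-roots {n = _}     lead    c≢0 []       _              _            = z≤n
AtMost-roots {n = zero}  p-const c≢0 (x ∷ _)  _              (px≡0 ∷ _)   =
  contradiction (trans (sym (p-const x)) px≡0) c≢0
AtMost-roots {n = suc n} {c} {p} lead c≢0 (y ∷ xs) (y∉xs ∷ unique) (py≡0 ∷ all)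
  with q , lead-q , p-p≡ ← HasLead-quotient {n = n} lead y =
  s≤s (AtMost-roots {n = n} lead-q c≢0 xs unique (All.zipWith quotient-root (y∉xs , all)))
  where
  quotient-root : ∀ {x} → y ≢ x × p x ≡ 0ℤ → q x ≡ 0ℤ
  quotient-root {x} (y≢x , px≡0)
    with ℤ.i*j≡0⇒i≡0∨j≡0 (x ℤ.- y) (trans (sym (p-p≡ x)) (cong₂ ℤ._-_ px≡0 py≡0))
  ... | inj₁ x-y≡0 = contradiction (sym (ℤ.i-j≡0⇒i≡j x y x-y≡0)) y≢x
  ... | inj₂ qx≡0  = qx≡0

AtMost-solutions : HasLead (suc n) c p → c ≢ 0ℤ → ∀ v → AtMost (suc n) (λ (x : ℕ) → p (pos x) ≡ v)
AtMost-solutions {n} {c} {p} (a , q , lead , p≡) c≢0 v xs unique all =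
  subst (_≤ suc n) (length-map pos xs)
    (AtMost-roots {n = suc n} {p = λ x → p x ℤ.- v}
      (a ℤ.- v , q , lead , λ x → trans (cong (ℤ._- v) (p≡ x)) (regroup a (x ℤ.* q x) v)) c≢0
      (map pos xs) (Unique.map⁺ ℤ.+-injective unique)
      (All.map⁺ (All.map ℤ.i≡j⇒i-j≡0 all)))
  where
  regroup : ∀ a s v → a ℤ.+ s ℤ.- v ≡ a ℤ.- v ℤ.+ s
  regroup = ℤ-Ring.solve-∀

Σ≤ : ℕ → (ℕ → ℤ) → ℤ
Σ≤ zero    h = h 0
Σ≤ (suc n) h = h 0 ℤ.+ Σ≤ n (h ∘ suc)

Σ≤-cong : ∀ n {g h : ℕ → ℤ} → (∀ i → g i ≡ h i) → Σ≤ n g ≡ Σ≤ n h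
Σ≤-cong zero    eq = eq 0
Σ≤-cong (suc n) eq = cong₂ ℤ._+_ (eq 0) (Σ≤-cong n (eq ∘ suc))

Σ≤-* : ∀ n k h → Σ≤ n (λ i → k ℤ.* h i) ≡ k ℤ.* Σ≤ n h
Σ≤-* zero    k h = refl
Σ≤-* (suc n) k h = trans (cong (λ s → k ℤ.* h 0 ℤ.+ s) (Σ≤-* n k (h ∘ suc))) (sym (ℤ.*-distribˡ-+ k (h 0) _))

Σ≤-+ : ∀ n g h → Σ≤ n (λ i → g i ℤ.+ h i) ≡ Σ≤ n g ℤ.+ Σ≤ n h
Σ≤-+ zero    g h = refl
Σ≤-+ (suc n) g h =
  trans (cong (λ s → g 0 ℤ.+ h 0 ℤ.+ s) (Σ≤-+ n (g ∘ suc) (h ∘ suc))) (interchange (g 0) (h 0) _ _)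
  where
  interchange : ∀ a b c d → a ℤ.+ b ℤ.+ (c ℤ.+ d) ≡ a ℤ.+ c ℤ.+ (b ℤ.+ d)
  interchange = ℤ-Ring.solve-∀

Σ≤-last : ∀ n h → Σ≤ (suc n) h ≡ Σ≤ n h ℤ.+ h (suc n)
Σ≤-last zero    h = refl
Σ≤-last (suc n) h = trans (cong (λ s → h 0 ℤ.+ s) (Σ≤-last n (h ∘ suc))) (sym (ℤ.+-assoc (h 0) _ _))

polynomial : ℕ → (ℕ → ℤ) → ℤ → ℤ
polynomial n b x = Σ≤ n (λ i → b i ℤ.* x ℤ.^ i)

polynomial-suc : ∀ n b x → polynomial (suc n) b x ≡ b 0 ℤ.+ x ℤ.* polynomial n (b ∘ suc) x
polynomial-suc n b x = cong₂ ℤ._+_ (ℤ.*-identityʳ (b 0))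
  (trans (Σ≤-cong n (λ i → regroup (b (suc i)) x (x ℤ.^ i))) (Σ≤-* n x _))
  where
  regroup : ∀ a x s → a ℤ.* (x ℤ.* s) ≡ x ℤ.* (a ℤ.* s)
  regroup = ℤ-Ring.solve-∀

HasLead-polynomial : ∀ n b → HasLead n (b n) (polynomial n b)
HasLead-polynomial zero    b = λ x → ℤ.*-identityʳ (b 0)
HasLead-polynomial (suc n) b = b 0 , _ , HasLead-polynomial n (b ∘ suc) , polynomial-suc n b

-- Dirichlet's theorem acts on coefficients, whereas a shifted polynomial is known only as a
-- function with `HasLead`.
coefficients : HasLead n c p → ∃ λ b → b n ≡ c × (∀ x → p x ≡ polynomial n b x)
coefficients {n = zero}  {c} p-const = (λ _ → c) , refl , λ x → trans (p-const x) (sym (ℤ.*-identityʳ c))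
coefficients {n = suc n} (a , q , lead , p≡) with b , b-n , q≡ ← coefficients {n = n} lead =
  cons , b-n , λ x → trans (p≡ x) (trans (cong (λ s → a ℤ.+ x ℤ.* s) (q≡ x)) (sym (polynomial-suc n cons x)))
  where
  cons : ℕ → ℤ
  cons zero    = a
  cons (suc i) = b i

-- The relation over ℤ is only known to have some nonzero coefficient in degree ≥ 2. Dropping
-- vanishing top coefficients supplies the nonzero leading coefficient that root counting needs.
HasLead-top : ∀ n b {j} → j ≤ n → b j ≢ 0ℤ →
              ∃ λ k → j ≤ k × k ≤ n × b k ≢ 0ℤ × HasLead k (b k) (polynomial n b)
HasLead-top n b j≤n bj≢0 with b n ℤ.≟ 0ℤ
HasLead-top n       b j≤n bj≢0 | no  bn≢0 = n , j≤n , ≤-refl , bn≢0 , HasLead-polynomial n b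
HasLead-top zero    b z≤n bj≢0 | yes b0≡0 = contradiction b0≡0 bj≢0
HasLead-top (suc n) b {j} j≤n bj≢0 | yes bn≡0
  with k , j≤k , k≤n , bk≢0 , lead ← HasLead-top n b
         (≤-pred (≤∧≢⇒< j≤n (λ j≡n → bj≢0 (trans (cong b j≡n) bn≡0)))) bj≢0 =
  k , j≤k , m≤n⇒m≤1+n k≤n , bk≢0 , HasLead-≗ {n = k} drop-last lead
  where
  drop-last : ∀ x → polynomial (suc n) b x ≡ polynomial n b x
  drop-last x = trans (Σ≤-last n _)
    (trans (cong (λ s → polynomial n b x ℤ.+ s ℤ.* x ℤ.^ suc n) bn≡0) (ℤ.+-identityʳ _))

sum-tabulate-* : ∀ n x (h : Fin n → ℕ) → sum (tabulate (λ i → x * h i)) ≡ x * sum (tabulate h)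
sum-tabulate-* zero    x h = sym (*-zeroʳ x)
sum-tabulate-* (suc n) x h =
  trans (cong (x * h Fin.zero +_) (sum-tabulate-* n x (h ∘ Fin.suc))) (sym (*-distribˡ-+ x _ _))

evalPoly-suc : ∀ d a x → evalPoly (suc d) a x ≡ a Fin.zero + x * evalPoly d (a ∘ Fin.suc) x
evalPoly-suc d a x = cong₂ _+_ (*-identityʳ (a Fin.zero)) (begin
  sum (map term (tabulate Fin.suc))
    ≡⟨ cong sum (map-tabulate Fin.suc term) ⟩
  sum (tabulate (λ i → a (Fin.suc i) * (x * x ^ Fin.toℕ i)))
    ≡⟨ cong sum (tabulate-cong (λ i → regroup (a (Fin.suc i)) x (x ^ Fin.toℕ i))) ⟩
  sum (tabulate (λ i → x * term′ i))
    ≡⟨ sum-tabulate-* (suc d) x term′ ⟩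
  x * sum (tabulate term′)
    ≡⟨ cong (λ ts → x * sum ts) (sym (map-tabulate id term′)) ⟩
  x * evalPoly d (a ∘ Fin.suc) x ∎)
  where
  open ≡-Reasoning
  term : Fin (suc (suc d)) → ℕ
  term i = a i * x ^ Fin.toℕ i
  term′ : Fin (suc d) → ℕ
  term′ i = a (Fin.suc i) * x ^ Fin.toℕ i
  regroup : ∀ a x s → a * (x * s) ≡ x * (a * s)
  regroup = ℕ-Ring.solve-∀

evalPoly-HasLead : ∀ d a →
  ∃ λ p → HasLead d (pos (lead d a)) p × (∀ x → p (pos x) ≡ pos (evalPoly d a x))
evalPoly-HasLead zero    a = (λ _ → pos (a Fin.zero)) , (λ _ → refl) ,
  λ x → cong pos (sym (trans (+-identityʳ _) (*-identityʳ (a Fin.zero))))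
evalPoly-HasLead (suc d) a with q , lead , q≡ ← evalPoly-HasLead d (a ∘ Fin.suc) =
  _ , (pos (a Fin.zero) , q , lead , λ _ → refl) , λ x → begin
    pos (a Fin.zero) ℤ.+ pos x ℤ.* q (pos x)
      ≡⟨ cong (λ s → pos (a Fin.zero) ℤ.+ pos x ℤ.* s) (q≡ x) ⟩
    pos (a Fin.zero) ℤ.+ pos x ℤ.* pos (evalPoly d (a ∘ Fin.suc) x)
      ≡⟨ cong (λ s → pos (a Fin.zero) ℤ.+ s) (sym (ℤ.pos-* x _)) ⟩
    pos (a Fin.zero + x * evalPoly d (a ∘ Fin.suc) x)
      ≡⟨ cong pos (sym (evalPoly-suc d a x)) ⟩
    pos (evalPoly (suc d) a x) ∎
  where open ≡-Reasoning

-- Solutions of p x + p y = p z + p w over the integers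

term-≤-∑ : ∀ {xs : List A} (g : A → ℕ) {x} → x ∈ xs → g x ≤ ∑ xs g
term-≤-∑ g (here refl)           = m≤m+n _ _
term-≤-∑ g (there {x = y} x∈xs) = m≤n⇒m≤o+n (g y) (term-≤-∑ g x∈xs)

∑-𝟙-≟-≤1 : ∀ {vs} → Unique vs → ∀ v → ∑ vs (λ u → 𝟙 (u ≟ v)) ≤ 1
∑-𝟙-≟-≤1 unique v = ∑-𝟙-≤ (_≟ v) at-most-one unique
  where
  at-most-one : AtMost 1 (_≡ v)
  at-most-one []          _                 _                 = z≤n
  at-most-one (_ ∷ [])    _                 _                 = s≤s z≤n
  at-most-one (x ∷ y ∷ _) ((x≢y ∷ _) ∷ _) (x≡v ∷ y≡v ∷ _) = contradiction (trans x≡v (sym y≡v)) x≢y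

module PolynomialEnergy
  (p : ℤ → ℤ) (n : ℕ) {c : ℤ} (p-lead : HasLead (suc (suc n)) c p) (c≢0 : c ≢ 0ℤ)
  (H R : ℕ)
  (few-divisors : ∀ {y w} → y ∈ interval H → w ∈ interval H →
    p (pos w) ℤ.- p (pos y) ≢ 0ℤ → AtMost R (_∣ abs (p (pos w) ℤ.- p (pos y))))
  where

  private
    I = interval H
    deg = suc (suc n)

    f : ℕ → ℤ
    f x = p (pos x)

    -- This is where degree ≥ 2 matters: the difference with gap r is still nonconstant, with
    -- leading coefficient deg · r · c.
    difference-solutions : ∀ {r} v → 1 ≤ r → AtMost (suc n) (λ (z : ℕ) → f (z + r) ℤ.- f z ≡ v)
    difference-solutions {r} v 1≤r = AtMost-solutions {n = n} (HasLead-Δ {n = suc n} (pos r) p-lead) lead≢0 v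
      where
      lead≢0 : pos deg ℤ.* (pos r ℤ.* c) ≢ 0ℤ
      lead≢0 eq with ℤ.i*j≡0⇒i≡0∨j≡0 (pos deg) eq
      ... | inj₁ ()
      ... | inj₂ rc≡0 with ℤ.i*j≡0⇒i≡0∨j≡0 (pos r) rc≡0
      ...   | inj₁ r≡0 = <⇒≢ 1≤r (sym (ℤ.+-injective r≡0))
      ...   | inj₂ c≡0 = c≢0 c≡0

    -- The second factor is written with a + r instead of b, so that summation over b removes the
    -- first factor.
    step : ℕ → ℤ → ℕ → ℕ → ℕ
    step r v a b = 𝟙 (b ≟ a + r) * 𝟙 (f (a + r) ℤ.- f a ℤ.≟ v)

    ∑-step-≤ : ∀ {r} v → 1 ≤ r → ∑ I (λ a → ∑ I (λ b → step r v a b)) ≤ suc n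
    ∑-step-≤ {r} v 1≤r = begin
      ∑ I (λ a → ∑ I (λ b → step r v a b))
        ≡⟨ ∑-cong I (λ a → ∑-*ʳ I (𝟙 (f (a + r) ℤ.- f a ℤ.≟ v)) _) ⟩
      ∑ I (λ a → ∑ I (λ b → 𝟙 (b ≟ a + r)) * 𝟙 (f (a + r) ℤ.- f a ℤ.≟ v))
        ≤⟨ ∑-mono I (λ a → ≤-trans (*-monoˡ-≤ _ (∑-𝟙-≟-≤1 (interval-unique H) (a + r))) (≤-reflexive (+-identityʳ _))) ⟩
      ∑ I (λ a → 𝟙 (f (a + r) ℤ.- f a ℤ.≟ v))
        ≤⟨ ∑-𝟙-≤ (λ a → f (a + r) ℤ.- f a ℤ.≟ v) (difference-solutions v 1≤r) (interval-unique H) ⟩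
      suc n ∎
      where open ≤-Reasoning

    step-at : ∀ {r v a b} → b ≡ a + r → f b ℤ.- f a ≡ v → 1 ≤ step r v a b
    step-at {r} {a = a} refl refl = ≤-reflexive (sym
      (cong₂ _*_ (𝟙-yes (a + r ≟ a + r) refl) (𝟙-yes (f (a + r) ℤ.- f a ℤ.≟ _) refl)))

    gap-∣ : ∀ r a → r ∣ abs (f (a + r) ℤ.- f a)
    gap-∣ r a with q , _ , f-f≡ ← HasLead-quotient {n = suc n} p-lead (pos a) =
      divides (abs (q (pos (a + r)))) (trans (cong abs (f-f≡ (pos (a + r))))
        (trans (ℤ.abs-* (pos (a + r) ℤ.- pos a) _)
          (trans (cong (λ s → abs s * abs (q (pos (a + r)))) (cancel (pos a) (pos r))) (*-comm r _))))
      where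
      cancel : ∀ s t → (s ℤ.+ t) ℤ.- s ≡ t
      cancel = ℤ-Ring.solve-∀

    -- A majorant for the condition f x - f z = v: the gap r runs over the divisors of v, and the
    -- two summands stand for x = z + r and z = x + r.
    steps : ℤ → ℕ → ℕ → ℕ
    steps v x z = ∑ I (λ r → 𝟙 (r ∣? abs v) * (step r v z x + step r (ℤ.- v) x z))

    steps-≥-step : ∀ {v r x z} → r ∈ I → r ∣ abs v → step r v z x + step r (ℤ.- v) x z ≤ steps v x z
    steps-≥-step {v} {r} {x} {z} r∈ r∣ = ≤-trans
      (≤-reflexive (trans (sym (+-identityʳ both)) (cong (_* both) (sym (𝟙-yes (r ∣? abs v) r∣)))))
      (term-≤-∑ (λ r → 𝟙 (r ∣? abs v) * (step r v z x + step r (ℤ.- v) x z)) r∈)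
      where both = step r v z x + step r (ℤ.- v) x z

    -- A nonzero difference f x − f z is divisible by |x − z|.
    difference-≤-steps : ∀ {v} → v ≢ 0ℤ → ∀ {x z} → x ∈ I → z ∈ I → 𝟙 (f x ℤ.- f z ℤ.≟ v) ≤ steps v x z
    difference-≤-steps {v} v≢0 {x} {z} x∈ z∈ with f x ℤ.- f z ℤ.≟ v
    ... | no  _    = z≤n
    ... | yes refl with <-cmp x z
    ...   | tri≈ _ refl _ = contradiction (ℤ.i≡j⇒i-j≡0 {f x} refl) v≢0
    ...   | tri< x<z _ _ = ≤-trans
      (≤-trans (step-at {r} {a = x} z≡ (neg (f x) (f z))) (m≤n+m _ (step r v z x)))
      (steps-≥-step {v} {r} {x} {z} (∈-interval⁺ (m<n⇒0<n∸m x<z) (≤-trans (m∸n≤m z x) (proj₂ (∈-interval⁻ z∈)))) r∣)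
      where
      r = z ∸ x
      z≡ : z ≡ x + r
      z≡ = sym (m+[n∸m]≡n (<⇒≤ x<z))
      r∣ : r ∣ abs v
      r∣ = subst (r ∣_) (trans (cong (λ b → abs (f b ℤ.- f x)) (sym z≡)) (ℤ.∣i-j∣≡∣j-i∣ (f z) (f x))) (gap-∣ r x)
      neg : ∀ s t → t ℤ.- s ≡ ℤ.- (s ℤ.- t)
      neg = ℤ-Ring.solve-∀
    ...   | tri> _ _ z<x = ≤-trans
      (≤-trans (step-at {r} {a = z} x≡ refl) (m≤m+n _ (step r (ℤ.- v) x z)))
      (steps-≥-step {v} {r} {x} {z} (∈-interval⁺ (m<n⇒0<n∸m z<x) (≤-trans (m∸n≤m x z) (proj₂ (∈-interval⁻ x∈)))) r∣)
      where
      r = x ∸ z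
      x≡ : x ≡ z + r
      x≡ = sym (m+[n∸m]≡n (<⇒≤ z<x))
      r∣ : r ∣ abs v
      r∣ = subst (r ∣_) (cong (λ b → abs (f b ℤ.- f z)) (sym x≡)) (gap-∣ r z)

    -- There are at most R gaps r. For each gap and each order of x and z, the smaller point solves
    -- f(a+r) - f(a) = ±v, which leaves at most n + 1 values.
    nonzero-difference-count : ∀ {v} → v ≢ 0ℤ → AtMost R (_∣ abs v) →
      ∑ I (λ x → ∑ I (λ z → 𝟙 (f x ℤ.- f z ℤ.≟ v))) ≤ R * (suc n + suc n)
    nonzero-difference-count {v} v≢0 few = begin
      ∑ I (λ x → ∑ I (λ z → 𝟙 (f x ℤ.- f z ℤ.≟ v)))
        ≤⟨ ∑-mono-∈ I (λ x∈ → ∑-mono-∈ I (λ z∈ → difference-≤-steps v≢0 x∈ z∈)) ⟩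
      ∑ I (λ x → ∑ I (λ z → ∑ I (λ r → δ r * both r x z)))
        ≡⟨ ∑-cong I (λ x → ∑-swap I I _) ⟩
      ∑ I (λ x → ∑ I (λ r → ∑ I (λ z → δ r * both r x z)))
        ≡⟨ ∑-swap I I _ ⟩
      ∑ I (λ r → ∑ I (λ x → ∑ I (λ z → δ r * both r x z)))
        ≡⟨ ∑-cong I (λ r → trans (∑-cong I (λ x → ∑-*ˡ I (δ r) _)) (∑-*ˡ I (δ r) _)) ⟩
      ∑ I (λ r → δ r * ∑ I (λ x → ∑ I (λ z → both r x z)))
        ≤⟨ ∑-mono-∈ I (λ {r} r∈ → *-monoʳ-≤ (δ r) (both-≤ (proj₁ (∈-interval⁻ r∈)))) ⟩
      ∑ I (λ r → δ r * (suc n + suc n))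
        ≡⟨ ∑-*ʳ I (suc n + suc n) δ ⟩
      ∑ I δ * (suc n + suc n)
        ≤⟨ *-monoˡ-≤ (suc n + suc n) (∑-𝟙-≤ (λ r → r ∣? abs v) few (interval-unique H)) ⟩
      R * (suc n + suc n) ∎
      where
      open ≤-Reasoning
      δ : ℕ → ℕ
      δ r = 𝟙 (r ∣? abs v)
      both : ℕ → ℕ → ℕ → ℕ
      both r x z = step r v z x + step r (ℤ.- v) x z
      both-≤ : ∀ {r} → 1 ≤ r → ∑ I (λ x → ∑ I (λ z → both r x z)) ≤ suc n + suc n
      both-≤ {r} 1≤r = begin
        ∑ I (λ x → ∑ I (λ z → both r x z))
          ≡⟨ trans (∑-cong I (λ x → ∑-+ I _ _)) (∑-+ I _ _) ⟩
        ∑ I (λ x → ∑ I (λ z → step r v z x)) + ∑ I (λ x → ∑ I (λ z → step r (ℤ.- v) x z))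
          ≡⟨ cong (_+ ∑ I (λ x → ∑ I (λ z → step r (ℤ.- v) x z))) (∑-swap I I _) ⟩
        ∑ I (λ z → ∑ I (λ x → step r v z x)) + ∑ I (λ x → ∑ I (λ z → step r (ℤ.- v) x z))
          ≤⟨ +-mono-≤ (∑-step-≤ v 1≤r) (∑-step-≤ (ℤ.- v) 1≤r) ⟩
        suc n + suc n ∎

    equal-values-count : ∀ v → ∑ I (λ x → 𝟙 (f x ℤ.- v ℤ.≟ 0ℤ)) ≤ deg
    equal-values-count v = ∑-𝟙-≤ (λ x → f x ℤ.- v ℤ.≟ 0ℤ)
      (λ xs unique all → AtMost-solutions {n = suc n} {p = p} p-lead c≢0 v xs unique
        (All.map (λ {x} → ℤ.i-j≡0⇒i≡j (f x) v) all))
      (interval-unique H)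

    -- The case of equal values f y = f w is kept as an indicator: it occurs for at most deg · H
    -- pairs (y, w), each admitting at most deg · H pairs (x, z), so in total it costs only deg² H².
    difference-count : ∀ {y w} → y ∈ I → w ∈ I →
      ∑ I (λ x → ∑ I (λ z → 𝟙 (f x ℤ.- f z ℤ.≟ f w ℤ.- f y)))
      ≤ 𝟙 (f w ℤ.- f y ℤ.≟ 0ℤ) * (H * deg) + R * (suc n + suc n)
    difference-count {y} {w} y∈ w∈ with f w ℤ.- f y ℤ.≟ 0ℤ
    ... | no  v≢0 = nonzero-difference-count v≢0 (few-divisors y∈ w∈ v≢0)
    ... | yes v≡0 = m≤n⇒m≤n+o _ (begin
      ∑ I (λ x → ∑ I (λ z → 𝟙 (f x ℤ.- f z ℤ.≟ f w ℤ.- f y)))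
        ≡⟨ ∑-swap I I _ ⟩
      ∑ I (λ z → ∑ I (λ x → 𝟙 (f x ℤ.- f z ℤ.≟ f w ℤ.- f y)))
        ≤⟨ ∑-mono I (λ z → ∑-mono I (λ x → 𝟙-mono (_ ℤ.≟ _) (_ ℤ.≟ _) (λ eq → trans eq v≡0))) ⟩
      ∑ I (λ z → ∑ I (λ x → 𝟙 (f x ℤ.- f z ℤ.≟ 0ℤ)))
        ≤⟨ ∑-≤-const I (λ {z} _ → equal-values-count (f z)) ⟩
      length I * deg
        ≡⟨ cong (_* deg) (interval-length H) ⟩
      H * deg
        ≡⟨ sym (+-identityʳ _) ⟩
      1 * (H * deg) ∎)
      where open ≤-Reasoning

  integer-energy : ℕ
  integer-energy = ∑ (I ²) (λ P → ∑ (I ²) (λ Q →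
    𝟙 ((f (proj₁ P) ℤ.+ f (proj₂ P)) ℤ.- (f (proj₁ Q) ℤ.+ f (proj₂ Q)) ℤ.≟ 0ℤ)))

  integer-energy-≤ : integer-energy ≤ H * H * (deg * deg + 2 * deg * R)
  integer-energy-≤ = begin
    integer-energy
      ≡⟨ ∑-²²-exchange I (λ x y z w → 𝟙 ((f x ℤ.+ f y) ℤ.- (f z ℤ.+ f w) ℤ.≟ 0ℤ)) ⟩
    ∑ (I ²) (λ P → ∑ (I ²) (λ Q → solves (proj₁ P) (proj₁ Q) (proj₂ P) (proj₂ Q)))
      ≡⟨ ∑-swap (I ²) (I ²) _ ⟩
    ∑ (I ²) (λ Q → ∑ (I ²) (λ P → solves (proj₁ P) (proj₁ Q) (proj₂ P) (proj₂ Q)))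
      ≡⟨ trans (∑-× I I _) (∑-cong I (λ y → ∑-cong I (λ w → ∑-× I I _))) ⟩
    ∑ I (λ y → ∑ I (λ w → ∑ I (λ x → ∑ I (λ z → solves x y z w))))
      ≤⟨ ∑-mono I (λ y → ∑-mono I (λ w → ∑-mono I (λ x → ∑-mono I (λ z →
           𝟙-mono (_ ℤ.≟ _) (_ ℤ.≟ _) (rearrange (f x) (f y) (f z) (f w)))))) ⟩
    ∑ I (λ y → ∑ I (λ w → ∑ I (λ x → ∑ I (λ z → 𝟙 (f x ℤ.- f z ℤ.≟ f w ℤ.- f y)))))
      ≤⟨ ∑-mono-∈ I (λ y∈ → ∑-mono-∈ I (λ w∈ → difference-count y∈ w∈)) ⟩
    ∑ I (λ y → ∑ I (λ w → 𝟙 (f w ℤ.- f y ℤ.≟ 0ℤ) * (H * deg) + E))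
      ≡⟨ ∑-cong I (λ y → trans (∑-+ I _ _) (cong (_+ ∑ I (λ _ → E)) (∑-*ʳ I (H * deg) _))) ⟩
    ∑ I (λ y → ∑ I (λ w → 𝟙 (f w ℤ.- f y ℤ.≟ 0ℤ)) * (H * deg) + ∑ I (λ _ → E))
      ≤⟨ ∑-≤-const I (λ {y} _ → +-mono-≤ (*-monoˡ-≤ (H * deg) (equal-values-count (f y)))
                                         (∑-≤-const I (λ _ → ≤-refl))) ⟩
    length I * (deg * (H * deg) + length I * E)
      ≡⟨ cong (λ l → l * (deg * (H * deg) + l * E)) (interval-length H) ⟩
    H * (deg * (H * deg) + H * (R * (suc n + suc n)))
      ≤⟨ *-monoʳ-≤ H (+-monoʳ-≤ (deg * (H * deg)) (*-monoʳ-≤ H (*-monoʳ-≤ R (+-mono-≤ (n≤1+n (suc n)) (n≤1+n (suc n)))))) ⟩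
    H * (deg * (H * deg) + H * (R * (deg + deg)))
      ≡⟨ regroup H deg R ⟩
    H * H * (deg * deg + 2 * deg * R) ∎
    where
    open ≤-Reasoning
    E = R * (suc n + suc n)
    solves : ℕ → ℕ → ℕ → ℕ → ℕ
    solves x y z w = 𝟙 ((f x ℤ.+ f y) ℤ.- (f z ℤ.+ f w) ℤ.≟ 0ℤ)
    rearrange : ∀ a b c e → (a ℤ.+ b) ℤ.- (c ℤ.+ e) ≡ 0ℤ → a ℤ.- c ≡ e ℤ.- b
    rearrange a b c e eq = ℤ.i-j≡0⇒i≡j (a ℤ.- c) (e ℤ.- b) (trans (shuffle a b c e) eq)
      where
      shuffle : ∀ a b c e → (a ℤ.- c) ℤ.- (e ℤ.- b) ≡ (a ℤ.+ b) ℤ.- (c ℤ.+ e)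
      shuffle = ℤ-Ring.solve-∀
    regroup : ∀ h d r → h * (d * (h * d) + h * (r * (d + d))) ≡ h * h * (d * d + 2 * d * r)
    regroup = ℕ-Ring.solve-∀

-- Dirichlet approximation and relations between moments

∏≤ : ℕ → (ℕ → ℕ) → ℕ
∏≤ zero    L = L 0
∏≤ (suc n) L = L 0 * ∏≤ n (L ∘ suc)

-- Numbers the boxes of a grid with L i cells in direction i, so that the pigeonhole principle for
-- `Fin` applies.
mixed-radix : ∀ n {L : ℕ → ℕ} → (∀ i → Fin (L i)) → Fin (∏≤ n L)
mixed-radix zero    digit = digit 0
mixed-radix (suc n) digit = combine (digit 0) (mixed-radix n (digit ∘ suc))

mixed-radix-injective : ∀ n {L : ℕ → ℕ} (digit digit′ : ∀ i → Fin (L i)) →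
  mixed-radix n digit ≡ mixed-radix n digit′ → ∀ {i} → i ≤ n → digit i ≡ digit′ i
mixed-radix-injective zero    digit digit′ eq z≤n = eq
mixed-radix-injective (suc n) digit digit′ eq {zero} z≤n =
  Fin.combine-injectiveˡ (digit 0) _ (digit′ 0) _ eq
mixed-radix-injective (suc n) digit digit′ eq (s≤s i≤n) =
  mixed-radix-injective n (digit ∘ suc) (digit′ ∘ suc) (Fin.combine-injectiveʳ (digit 0) _ (digit′ 0) _ eq) i≤n

-- Simultaneous approximation of the fractions b i / M with common denominator t: the error of t (b
-- i / M) against the integer `near i` is below 1 / L i. All inequalities are multiplied out.
record Approximation (n : ℕ) (L : ℕ → ℕ) (M : ℕ) (b : ℕ → ℤ) : Set where
  field
    t         : ℕ
    1≤t       : 1 ≤ t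
    t≤∏       : t ≤ ∏≤ n L
    near err  : ℕ → ℤ
    t*b≡      : ∀ i → pos t ℤ.* b i ≡ pos M ℤ.* near i ℤ.+ err i
    err-small : ∀ {i} → i ≤ n → L i * abs (err i) < M

-- Among the multiples s b with 0 ≤ s ≤ ∏ L i, two have all residues modulo M in the same box, where
-- box i is the integer part of L i times the residue over M. Their difference gives t.
dirichlet : ∀ n L → (∀ i → 1 ≤ L i) → ∀ M .{{_ : NonZero M}} b → Approximation n L M b
dirichlet n L 1≤L M b with Fin.pigeonhole (n<1+n (∏≤ n L)) (λ s → mixed-radix n (digit (Fin.toℕ s)))
  where
  ρ : ℕ → ℕ → ℕ
  ρ s i = (pos s ℤ.* b i) %ℕ M
  digit : ℕ → ∀ i → Fin (L i)
  digit s i = fromℕ< (m<n*o⇒m/o<n {L i * ρ s i} {L i} (*-monoʳ-< (L i) {{>-nonZero (1≤L i)}} (n%ℕd<d (pos s ℤ.* b i) M)))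
... | s₁ , s₂ , s₁<s₂ , same = record
  { t         = T₂ ∸ T₁
  ; 1≤t       = m<n⇒0<n∸m s₁<s₂
  ; t≤∏       = ≤-trans (m∸n≤m T₂ T₁) (≤-pred (Fin.toℕ<n s₂))
  ; near      = λ i → quo T₂ i ℤ.- quo T₁ i
  ; err       = λ i → pos (rem T₂ i) ℤ.- pos (rem T₁ i)
  ; t*b≡      = split
  ; err-small = small
  }
  where
  open ≡-Reasoning
  T₁ = Fin.toℕ s₁
  T₂ = Fin.toℕ s₂
  rem : ℕ → ℕ → ℕ
  rem s i = (pos s ℤ.* b i) %ℕ M
  quo : ℕ → ℕ → ℤ
  quo s i = (pos s ℤ.* b i) /ℕ M

  split : ∀ i → pos (T₂ ∸ T₁) ℤ.* b i
                ≡ pos M ℤ.* (quo T₂ i ℤ.- quo T₁ i) ℤ.+ (pos (rem T₂ i) ℤ.- pos (rem T₁ i))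
  split i = begin
    pos (T₂ ∸ T₁) ℤ.* b i
      ≡⟨ cancel (pos T₁) (pos (T₂ ∸ T₁)) (b i) ⟩
    (pos T₁ ℤ.+ pos (T₂ ∸ T₁)) ℤ.* b i ℤ.- pos T₁ ℤ.* b i
      ≡⟨ cong (λ s → pos s ℤ.* b i ℤ.- pos T₁ ℤ.* b i) (m+[n∸m]≡n (<⇒≤ s₁<s₂)) ⟩
    pos T₂ ℤ.* b i ℤ.- pos T₁ ℤ.* b i
      ≡⟨ cong₂ ℤ._-_ (a≡a%ℕn+[a/ℕn]*n (pos T₂ ℤ.* b i) M) (a≡a%ℕn+[a/ℕn]*n (pos T₁ ℤ.* b i) M) ⟩
    (pos (rem T₂ i) ℤ.+ quo T₂ i ℤ.* pos M) ℤ.- (pos (rem T₁ i) ℤ.+ quo T₁ i ℤ.* pos M)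
      ≡⟨ regroup (pos (rem T₂ i)) (quo T₂ i) (pos (rem T₁ i)) (quo T₁ i) (pos M) ⟩
    pos M ℤ.* (quo T₂ i ℤ.- quo T₁ i) ℤ.+ (pos (rem T₂ i) ℤ.- pos (rem T₁ i)) ∎
    where
    cancel : ∀ s t b → t ℤ.* b ≡ (s ℤ.+ t) ℤ.* b ℤ.- s ℤ.* b
    cancel = ℤ-Ring.solve-∀
    regroup : ∀ r q r′ q′ m → (r ℤ.+ q ℤ.* m) ℤ.- (r′ ℤ.+ q′ ℤ.* m) ≡ m ℤ.* (q ℤ.- q′) ℤ.+ (r ℤ.- r′)
    regroup = ℤ-Ring.solve-∀

  small : ∀ {i} → i ≤ n → L i * abs (pos (rem T₂ i) ℤ.- pos (rem T₁ i)) < M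
  -- Equal boxes mean that `X₁` and `X₂` have the same quotient by `M`, so they differ by less than
  -- `M`.
  small {i} i≤n = subst (_< M) (begin
    abs (pos (X₂ % M) ℤ.- pos (X₁ % M))
      ≡⟨ cong abs (cancel (pos (X₂ % M)) (pos (X₁ % M)) (pos (X₂ / M * M))) ⟩
    abs (pos (X₂ % M + X₂ / M * M) ℤ.- pos (X₁ % M + X₂ / M * M))
      ≡⟨ cong₂ (λ u v → abs (pos u ℤ.- pos v)) (sym (m≡m%n+[m/n]*n X₂ M))
           (trans (cong (λ q → X₁ % M + q * M) X₂/M≡X₁/M) (sym (m≡m%n+[m/n]*n X₁ M))) ⟩
    abs (pos X₂ ℤ.- pos X₁)
      ≡⟨ cong abs (trans (cong₂ ℤ._-_ (ℤ.pos-* (L i) (rem T₂ i)) (ℤ.pos-* (L i) (rem T₁ i)))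
           (factor (pos (L i)) (pos (rem T₂ i)) (pos (rem T₁ i)))) ⟩
    abs (pos (L i) ℤ.* (pos (rem T₂ i) ℤ.- pos (rem T₁ i)))
      ≡⟨ ℤ.abs-* (pos (L i)) _ ⟩
    L i * abs (pos (rem T₂ i) ℤ.- pos (rem T₁ i)) ∎)
    (abs-pos-pos< (m%n<n X₂ M) (m%n<n X₁ M))
    where
    X₁ = L i * rem T₁ i
    X₂ = L i * rem T₂ i
    X₂/M≡X₁/M : X₂ / M ≡ X₁ / M
    X₂/M≡X₁/M = sym (trans (sym (Fin.toℕ-fromℕ< _))
      (trans (cong Fin.toℕ (mixed-radix-injective n _ _ same i≤n)) (Fin.toℕ-fromℕ< _)))
    cancel : ∀ u v w → u ℤ.- v ≡ (u ℤ.+ w) ℤ.- (v ℤ.+ w)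
    cancel = ℤ-Ring.solve-∀
    factor : ∀ l u v → l ℤ.* u ℤ.- l ℤ.* v ≡ l ℤ.* (u ℤ.- v)
    factor = ℤ-Ring.solve-∀

-- The factor k stands for term bounds of the form X / k without dividing.
abs-Σ≤ : ∀ n g k {X} → (∀ {i} → i ≤ n → k * abs (g i) ≤ X) → k * abs (Σ≤ n g) ≤ suc n * X
abs-Σ≤ zero    g k {X} le = ≤-trans (le z≤n) (≤-reflexive (sym (*-identityˡ X)))
abs-Σ≤ (suc n) g k {X} le = begin
  k * abs (g 0 ℤ.+ Σ≤ n (g ∘ suc))           ≤⟨ *-monoʳ-≤ k (ℤ.∣i+j∣≤∣i∣+∣j∣ (g 0) _) ⟩
  k * (abs (g 0) + abs (Σ≤ n (g ∘ suc)))     ≡⟨ *-distribˡ-+ k (abs (g 0)) _ ⟩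
  k * abs (g 0) + k * abs (Σ≤ n (g ∘ suc))   ≤⟨ +-mono-≤ (le z≤n) (abs-Σ≤ n (g ∘ suc) k (le ∘ s≤s)) ⟩
  X + suc n * X                              ∎
  where open ≤-Reasoning

argmax : ∀ n (h : ℕ → ℕ) → ∃ λ j → j ≤ n × (∀ {i} → i ≤ n → h i ≤ h j)
argmax zero    h = 0 , z≤n , λ { z≤n → ≤-refl }
argmax (suc n) h with j , j≤n , max ← argmax n (h ∘ suc) with ≤-total (h 0) (h (suc j))
... | inj₁ h0≤ = suc j , s≤s j≤n , λ { {zero} _ → h0≤ ; {suc i} (s≤s i≤n) → max i≤n }
... | inj₂ ≤h0 = 0 , z≤n , λ { {zero} _ → ≤-refl ; {suc i} (s≤s i≤n) → ≤-trans (max i≤n) ≤h0 }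

infix 8 _·_[_]
_·_[_] : (b u : ℕ → ℤ) → ℕ → ℤ
b · u [ n ] = Σ≤ n (λ i → b i ℤ.* u i)

-- The factor H^i balances the size 4 H^i of the i-th moment. The constant exceeds 4(n + 1) by one,
-- so that n + 1 terms, each at most 4M over it, sum to strictly less than M.
radii : ℕ → ℕ → ℕ → ℕ
radii n H i = suc (4 * suc n) * H ^ i

module Annihilators (n H : ℕ) (1≤H : 1 ≤ H) where

  private
    instance
      H≢0 : NonZero H
      H≢0 = >-nonZero 1≤H

    K = suc (4 * suc n)

  1≤radii : ∀ i → 1 ≤ radii n H i
  1≤radii i = ≤-trans (m^n>0 H i) (m≤n*m (H ^ i) K)

  -- The sum `err · u` is a multiple of M smaller than M, hence zero. The modulus is general because
  -- the lemma serves twice: for m, where `err` is the new relation, and for the peak of that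
  -- relation, where `near` is.
  approximation-orthogonal : ∀ {M} .{{_ : NonZero M}} {b} (A : Approximation n (radii n H) M b) →
    let open Approximation A in
    ∀ {u} → (∀ i → abs (u i) ≤ 4 * H ^ i) → pos M ∣ℤ b · u [ n ] →
    err · u [ n ] ≡ 0ℤ × pos t ℤ.* b · u [ n ] ≡ pos M ℤ.* near · u [ n ]
  approximation-orthogonal {M} {b} A {u} u-small M∣b·u = e·u≡0 ,
    trans t*b·u≡ (trans (cong (λ s → pos M ℤ.* near · u [ n ] ℤ.+ s) e·u≡0) (ℤ.+-identityʳ _))
    where
    open Approximation A
    t*b·u≡ : pos t ℤ.* b · u [ n ] ≡ pos M ℤ.* near · u [ n ] ℤ.+ err · u [ n ]
    t*b·u≡ = begin
      pos t ℤ.* b · u [ n ]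
        ≡⟨ sym (Σ≤-* n (pos t) _) ⟩
      Σ≤ n (λ i → pos t ℤ.* (b i ℤ.* u i))
        ≡⟨ Σ≤-cong n (λ i → trans (sym (ℤ.*-assoc (pos t) (b i) (u i)))
             (trans (cong (ℤ._* u i) (t*b≡ i)) (distribute (pos M) (near i) (err i) (u i)))) ⟩
      Σ≤ n (λ i → pos M ℤ.* (near i ℤ.* u i) ℤ.+ err i ℤ.* u i)
        ≡⟨ Σ≤-+ n _ _ ⟩
      Σ≤ n (λ i → pos M ℤ.* (near i ℤ.* u i)) ℤ.+ err · u [ n ]
        ≡⟨ cong (ℤ._+ err · u [ n ]) (Σ≤-* n (pos M) _) ⟩
      pos M ℤ.* near · u [ n ] ℤ.+ err · u [ n ] ∎
      where
      open ≡-Reasoning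
      distribute : ∀ m c e u → (m ℤ.* c ℤ.+ e) ℤ.* u ≡ m ℤ.* (c ℤ.* u) ℤ.+ e ℤ.* u
      distribute = ℤ-Ring.solve-∀
    M∣e·u : pos M ∣ℤ err · u [ n ]
    M∣e·u = Signed.∣m+n∣m⇒∣n (subst (pos M ∣ℤ_) t*b·u≡ (Signed.∣n⇒∣m*n (pos t) M∣b·u))
                              (Signed.∣m⇒∣m*n (near · u [ n ]) Signed.∣-refl)
    term-small : ∀ {i} → i ≤ n → K * abs (err i ℤ.* u i) ≤ 4 * M
    term-small {i} i≤n = begin
      K * abs (err i ℤ.* u i)           ≡⟨ cong (K *_) (ℤ.abs-* (err i) (u i)) ⟩
      K * (abs (err i) * abs (u i))     ≤⟨ *-monoʳ-≤ K (*-monoʳ-≤ (abs (err i)) (u-small i)) ⟩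
      K * (abs (err i) * (4 * H ^ i))   ≡⟨ regroup K (abs (err i)) (H ^ i) ⟩
      4 * (K * H ^ i * abs (err i))     ≤⟨ *-monoʳ-≤ 4 (<⇒≤ (err-small i≤n)) ⟩
      4 * M                             ∎
      where
      open ≤-Reasoning
      regroup : ∀ k e h → k * (e * (4 * h)) ≡ 4 * (k * h * e)
      regroup = ℕ-Ring.solve-∀
    e·u<M : abs (err · u [ n ]) < M
    e·u<M = *-cancelˡ-< K _ _ (begin-strict
      K * abs (err · u [ n ])   ≤⟨ abs-Σ≤ n _ K term-small ⟩
      suc n * (4 * M)           ≡⟨ regroup (suc n) M ⟩
      4 * suc n * M             <⟨ m<n+m (4 * suc n * M) (>-nonZero⁻¹ M) ⟩
      K * M                     ∎)
      where
      open ≤-Reasoning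
      regroup : ∀ n m → n * (4 * m) ≡ 4 * n * m
      regroup = ℕ-Ring.solve-∀
    e·u≡0 : err · u [ n ] ≡ 0ℤ
    e·u≡0 = small-multiple≡0 e·u<M M∣e·u

moment : (x y z w : ℤ) → ℕ → ℤ
moment x y z w i = (x ℤ.^ i ℤ.+ y ℤ.^ i) ℤ.- (z ℤ.^ i ℤ.+ w ℤ.^ i)

polynomial-moments : ∀ n b x y z w →
  (polynomial n b x ℤ.+ polynomial n b y) ℤ.- (polynomial n b z ℤ.+ polynomial n b w)
  ≡ b · moment x y z w [ n ]
polynomial-moments n b x y z w = go n b _ _ _ _
  where
  go : ∀ n b X Y Z W →
       (b · X [ n ] ℤ.+ b · Y [ n ]) ℤ.- (b · Z [ n ] ℤ.+ b · W [ n ])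
       ≡ b · (λ i → (X i ℤ.+ Y i) ℤ.- (Z i ℤ.+ W i)) [ n ]
  go zero    b X Y Z W = factor (b 0) (X 0) (Y 0) (Z 0) (W 0)
    where
    factor : ∀ b x y z w → (b ℤ.* x ℤ.+ b ℤ.* y) ℤ.- (b ℤ.* z ℤ.+ b ℤ.* w) ≡ b ℤ.* ((x ℤ.+ y) ℤ.- (z ℤ.+ w))
    factor = ℤ-Ring.solve-∀
  go (suc n) b X Y Z W = trans
    (regroup (b 0) (X 0) (Y 0) (Z 0) (W 0) _ _ _ _)
    (cong (λ s → b 0 ℤ.* ((X 0 ℤ.+ Y 0) ℤ.- (Z 0 ℤ.+ W 0)) ℤ.+ s)
      (go n (b ∘ suc) (X ∘ suc) (Y ∘ suc) (Z ∘ suc) (W ∘ suc)))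
    where
    regroup : ∀ b x y z w s t u v →
      ((b ℤ.* x ℤ.+ s) ℤ.+ (b ℤ.* y ℤ.+ t)) ℤ.- ((b ℤ.* z ℤ.+ u) ℤ.+ (b ℤ.* w ℤ.+ v))
      ≡ b ℤ.* ((x ℤ.+ y) ℤ.- (z ℤ.+ w)) ℤ.+ ((s ℤ.+ t) ℤ.- (u ℤ.+ v))
    regroup = ℤ-Ring.solve-∀

abs-pos-^ : ∀ x i → abs (pos x ℤ.^ i) ≡ x ^ i
abs-pos-^ x zero    = refl
abs-pos-^ x (suc i) = trans (ℤ.abs-* (pos x) _) (cong (x *_) (abs-pos-^ x i))

moment-≤ : ∀ {H x y z w} → x ≤ H → y ≤ H → z ≤ H → w ≤ H →
           ∀ i → abs (moment (pos x) (pos y) (pos z) (pos w) i) ≤ 4 * H ^ i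
moment-≤ {H} {x} {y} {z} {w} x≤ y≤ z≤ w≤ i = ≤-trans (ℤ.∣i-j∣≤∣i∣+∣j∣ (pos x ℤ.^ i ℤ.+ pos y ℤ.^ i) (pos z ℤ.^ i ℤ.+ pos w ℤ.^ i))
  (≤-trans (+-mono-≤ (two x≤ y≤) (two z≤ w≤)) (≤-reflexive (collect (H ^ i))))
  where
  two : ∀ {x y} → x ≤ H → y ≤ H → abs (pos x ℤ.^ i ℤ.+ pos y ℤ.^ i) ≤ H ^ i + H ^ i
  two {x} {y} x≤ y≤ = ≤-trans (ℤ.∣i+j∣≤∣i∣+∣j∣ (pos x ℤ.^ i) (pos y ℤ.^ i))
    (+-mono-≤ (≤-trans (≤-reflexive (abs-pos-^ x i)) (^-monoˡ-≤ i x≤))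
              (≤-trans (≤-reflexive (abs-pos-^ y i)) (^-monoˡ-≤ i y≤)))
  collect : ∀ h → h + h + (h + h) ≡ 4 * h
  collect = ℕ-Ring.solve-∀

-- From a congruence to an equation over ℤ

-- Bounds the sum of |u_i| over 2 ≤ i ≤ n + 2: there are n + 1 moments, each at most 4 H^(n+2).
linear-factor : ℕ → ℕ → ℕ
linear-factor n H = suc n * (4 * H ^ suc (suc n))

-- Comes from M · near = t · tame - err with t ≤ `Q`, |tame| ≤ (`W` + 1) M and |err| < M.
coefficient-bound : ℕ → ℕ → ℕ
coefficient-bound n H = ∏≤ (suc (suc n)) (radii (suc (suc n)) H) * suc (linear-factor n H) + 1

module _ (n H : ℕ) (1≤H : 1 ≤ H) where

  private
    instance
      H≢0 : NonZero H
      H≢0 = >-nonZero 1≤H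

    d = suc (suc n)
    W = linear-factor n H
    Q = ∏≤ d (radii d H)

    open Annihilators d H 1≤H

  -- All that is used of moment sequences. The zeroth moment is 1 + 1 - 1 - 1, so constant
  -- coefficients never matter.
  Moments : (ℕ → ℤ) → Set
  Moments u = u 0 ≡ 0ℤ × (∀ i → abs (u i) ≤ 4 * H ^ i)

  private
    err-≤ : ∀ {M b} (approx : Approximation d (radii d H) M b) → ∀ {i} → i ≤ d → abs (Approximation.err approx i) < M
    err-≤ approx {i} i≤d =
      ≤-<-trans (m≤n*m (abs (Approximation.err approx i)) (radii d H i) {{>-nonZero (1≤radii i)}}) (Approximation.err-small approx i≤d)

  module Tame (e : ℕ → ℤ) {j : ℕ} (j≤n : j ≤ n)
              (e-≤M : ∀ {i} → i ≤ n → abs (e (suc (suc i))) ≤ abs (e (suc (suc j))))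
              (1≤M : 1 ≤ abs (e (suc (suc j)))) where

    private
      M = abs (e (suc (suc j)))

      instance
        M≢0 : NonZero M
        M≢0 = >-nonZero 1≤M

    linear : ℤ
    linear with abs (e 1) ≤? W * M
    ... | yes _ = e 1
    ... | no  _ = 0ℤ

    -- The constant coefficient, which meets only u 0 = 0, is set to 0: nothing bounds e 0 in terms
    -- of M.
    tame : ℕ → ℤ
    tame 0             = 0ℤ
    tame 1             = linear
    tame (suc (suc i)) = e (suc (suc i))

    tame-≤ : ∀ {i} → i ≤ d → abs (tame i) ≤ suc W * M
    tame-≤ {0}           _               = z≤n
    tame-≤ {1}           _ with abs (e 1) ≤? W * M
    ... | yes e₁≤ = m≤n⇒m≤o+n M e₁≤
    ... | no  _   = z≤n
    tame-≤ {suc (suc i)} (s≤s (s≤s i≤n)) = m≤n⇒m≤n+o (W * M) (e-≤M i≤n)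

    -- A dominating linear coefficient forces the first moment to vanish, so it can be dropped.
    linear≡ : ∀ {u} → Moments u → e · u [ d ] ≡ 0ℤ → linear ℤ.* u 1 ≡ e 1 ℤ.* u 1
    linear≡ {u} (u₀≡0 , u-small) e·u≡0 with abs (e 1) ≤? W * M
    ... | yes _   = refl
    ... | no  e₁> = sym (trans (cong (e 1 ℤ.*_) u₁≡0) (ℤ.*-zeroʳ (e 1)))
      where
      tail = Σ≤ n (λ i → e (suc (suc i)) ℤ.* u (suc (suc i)))
      e₁u₁≡ : e 1 ℤ.* u 1 ≡ ℤ.- tail
      e₁u₁≡ = ℤ.i-j≡0⇒i≡j (e 1 ℤ.* u 1) (ℤ.- tail) (trans (expand (e 0) (e 1 ℤ.* u 1) tail)
        (trans (cong (λ s → e 0 ℤ.* s ℤ.+ (e 1 ℤ.* u 1 ℤ.+ tail)) (sym u₀≡0)) e·u≡0))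
        where
        expand : ∀ a s t → s ℤ.- (ℤ.- t) ≡ a ℤ.* 0ℤ ℤ.+ (s ℤ.+ t)
        expand = ℤ-Ring.solve-∀
      tail-term : ∀ {i} → i ≤ n → 1 * abs (e (suc (suc i)) ℤ.* u (suc (suc i))) ≤ M * (4 * H ^ d)
      tail-term {i} i≤n = begin
        1 * abs (e (suc (suc i)) ℤ.* u (suc (suc i)))   ≡⟨ *-identityˡ _ ⟩
        abs (e (suc (suc i)) ℤ.* u (suc (suc i)))       ≡⟨ ℤ.abs-* (e (suc (suc i))) _ ⟩
        abs (e (suc (suc i))) * abs (u (suc (suc i)))   ≤⟨ *-mono-≤ (e-≤M i≤n) (u-small (suc (suc i))) ⟩
        M * (4 * H ^ suc (suc i))                       ≤⟨ *-monoʳ-≤ M (*-monoʳ-≤ 4 (^-monoʳ-≤ H (s≤s (s≤s i≤n)))) ⟩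
        M * (4 * H ^ d)                                 ∎
        where open ≤-Reasoning
      e₁u₁≤ : abs (e 1) * abs (u 1) ≤ W * M
      e₁u₁≤ = begin
        abs (e 1) * abs (u 1)   ≡⟨ sym (ℤ.abs-* (e 1) (u 1)) ⟩
        abs (e 1 ℤ.* u 1)       ≡⟨ trans (cong abs e₁u₁≡) (ℤ.∣-i∣≡∣i∣ tail) ⟩
        abs tail                ≡⟨ sym (*-identityˡ _) ⟩
        1 * abs tail            ≤⟨ abs-Σ≤ n _ 1 tail-term ⟩
        suc n * (M * (4 * H ^ d)) ≡⟨ regroup (suc n) M (4 * H ^ d) ⟩
        W * M                   ∎
        where
        open ≤-Reasoning
        regroup : ∀ a b c → a * (b * c) ≡ a * c * b
        regroup = ℕ-Ring.solve-∀
      u₁≡0 : u 1 ≡ 0ℤ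
      u₁≡0 with abs (u 1) ≟ 0
      ... | yes abs≡0 = ℤ.∣i∣≡0⇒i≡0 abs≡0
      ... | no  abs≢0 = contradiction (≤-trans (m≤m*n (abs (e 1)) (abs (u 1)) {{≢-nonZero abs≢0}}) e₁u₁≤) e₁>

    tame-orthogonal : ∀ {u} → Moments u → e · u [ d ] ≡ 0ℤ → tame · u [ d ] ≡ 0ℤ
    tame-orthogonal {u} mu@(u₀≡0 , _) e·u≡0 = trans
      (cong₂ ℤ._+_
        (trans (cong (0ℤ ℤ.*_) u₀≡0) (sym (trans (cong (e 0 ℤ.*_) u₀≡0) (ℤ.*-zeroʳ (e 0)))))
        (cong (ℤ._+ Σ≤ n (λ i → e (suc (suc i)) ℤ.* u (suc (suc i)))) (linear≡ {u} mu e·u≡0)))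
      e·u≡0

    module _ (approx : Approximation d (radii d H) M tame) where

      open Approximation approx

      -- At the index of the peak, t times the coefficient has absolute value at least M and cannot
      -- be the error alone, which is below M.
      near-peak≢0 : near (suc (suc j)) ≢ 0ℤ
      near-peak≢0 near≡0 = <⇒≱ (err-≤ approx j+2≤d) (begin
        M                                        ≤⟨ m≤n*m M t {{>-nonZero 1≤t}} ⟩
        t * M                                    ≡⟨ sym (ℤ.abs-* (pos t) (e (suc (suc j)))) ⟩
        abs (pos t ℤ.* e (suc (suc j)))          ≡⟨ cong abs (t*b≡ (suc (suc j))) ⟩
        abs (pos M ℤ.* near (suc (suc j)) ℤ.+ err (suc (suc j)))
          ≡⟨ cong abs (trans (cong (λ s → pos M ℤ.* s ℤ.+ err (suc (suc j))) near≡0)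
               (trans (cong (ℤ._+ err (suc (suc j))) (ℤ.*-zeroʳ (pos M))) (ℤ.+-identityˡ (err (suc (suc j)))))) ⟩
        abs (err (suc (suc j)))                  ∎)
        where
        open ≤-Reasoning
        j+2≤d : suc (suc j) ≤ d
        j+2≤d = s≤s (s≤s j≤n)

      near-≤ : ∀ {i} → i ≤ d → abs (near i) ≤ coefficient-bound n H
      near-≤ {i} i≤d = *-cancelˡ-≤ M (begin
        M * abs (near i)                      ≡⟨ sym (ℤ.abs-* (pos M) (near i)) ⟩
        abs (pos M ℤ.* near i)                ≡⟨ cong abs (solve-for (pos M ℤ.* near i) (err i)) ⟩
        abs ((pos M ℤ.* near i ℤ.+ err i) ℤ.- err i)
          ≡⟨ cong (λ s → abs (s ℤ.- err i)) (sym (t*b≡ i)) ⟩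
        abs (pos t ℤ.* tame i ℤ.- err i)      ≤⟨ ℤ.∣i-j∣≤∣i∣+∣j∣ (pos t ℤ.* tame i) (err i) ⟩
        abs (pos t ℤ.* tame i) + abs (err i)  ≡⟨ cong (_+ abs (err i)) (ℤ.abs-* (pos t) (tame i)) ⟩
        t * abs (tame i) + abs (err i)        ≤⟨ +-mono-≤ (*-mono-≤ t≤∏ (tame-≤ i≤d)) (<⇒≤ (err-≤ approx i≤d)) ⟩
        Q * (suc W * M) + M                   ≡⟨ regroup Q (suc W) M ⟩
        M * (Q * suc W + 1)                   ∎)
        where
        open ≤-Reasoning
        solve-for : ∀ s e → s ≡ (s ℤ.+ e) ℤ.- e
        solve-for = ℤ-Ring.solve-∀
        regroup : ∀ q w m → q * (w * m) + m ≡ m * (q * w + 1)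
        regroup = ℕ-Ring.solve-∀

      -- Zero is a multiple of M, so `tame · u` = 0 meets the divisibility hypothesis of
      -- `approximation-orthogonal`, and 0 = t (`tame · u`) = M (`near · u`).
      near-orthogonal : ∀ {u} → Moments u → e · u [ d ] ≡ 0ℤ → near · u [ d ] ≡ 0ℤ
      near-orthogonal {u} mu e·u≡0 = cancel-M (ℤ.i*j≡0⇒i≡0∨j≡0 (pos M) (begin
        pos M ℤ.* near · u [ d ]   ≡⟨ sym (proj₂ (approximation-orthogonal approx {u} (proj₂ mu) M∣tame·u)) ⟩
        pos t ℤ.* tame · u [ d ]   ≡⟨ cong (pos t ℤ.*_) tame·u≡0 ⟩
        pos t ℤ.* 0ℤ               ≡⟨ ℤ.*-zeroʳ (pos t) ⟩
        0ℤ                         ∎))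
        where
        open ≡-Reasoning
        tame·u≡0 : tame · u [ d ] ≡ 0ℤ
        tame·u≡0 = tame-orthogonal {u} mu e·u≡0
        M∣tame·u : pos M ∣ℤ tame · u [ d ]
        M∣tame·u = subst (pos M ∣ℤ_) (sym tame·u≡0) (Signed.divides 0ℤ refl)
        cancel-M : pos M ≡ 0ℤ ⊎ near · u [ d ] ≡ 0ℤ → near · u [ d ] ≡ 0ℤ
        cancel-M (inj₁ M≡0) = contradiction (sym (ℤ.+-injective M≡0)) (<⇒≢ 1≤M)
        cancel-M (inj₂ eq)  = eq

  small-annihilator : ∀ e → e d ≢ 0ℤ → ∃ λ c →
    (∃ λ j → 2 ≤ j × j ≤ d × c j ≢ 0ℤ) ×
    (∀ {i} → i ≤ d → abs (c i) ≤ coefficient-bound n H) ×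
    (∀ {u} → Moments u → e · u [ d ] ≡ 0ℤ → c · u [ d ] ≡ 0ℤ)
  small-annihilator e e-top≢0 with argmax n (λ i → abs (e (suc (suc i))))
  ... | j , j≤n , max =
    near , (suc (suc j) , s≤s (s≤s z≤n) , s≤s (s≤s j≤n) , near-peak≢0 approx) , near-≤ approx ,
    (λ {u} → near-orthogonal approx {u})
    where
    1≤M : 1 ≤ abs (e (suc (suc j)))
    1≤M = ≤-trans (n≢0⇒n>0 (λ abs≡0 → e-top≢0 (ℤ.∣i∣≡0⇒i≡0 abs≡0))) (max ≤-refl)
    open Tame e j≤n max 1≤M
    approx = dirichlet d (radii d H) 1≤radii _ {{>-nonZero 1≤M}} tame
    open Approximation approx

  module _ (m : ℕ) .{{_ : NonZero m}} (Q<m : Q < m) {a : ℕ} (a-coprime : Coprime a m)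
           (p : ℤ → ℤ) (p-lead : HasLead d (pos a) p) where

    private
      f : ℕ → ℤ
      f x = p (pos x)

    -- One g serves all solutions in the interval, and its values are bounded independently of m.
    IntegerRelation : Set
    IntegerRelation = ∃ λ k → ∃ λ l → ∃ λ (g : ℤ → ℤ) →
      k ≤ n × l ≢ 0ℤ × HasLead (suc (suc k)) l g ×
      (∀ {x} → x ≤ H → abs (g (pos x)) ≤ suc d * (coefficient-bound n H * H ^ d)) ×
      (∀ {x y z w} → x ≤ H → y ≤ H → z ≤ H → w ≤ H → pos m ∣ℤ (f x ℤ.+ f y) ℤ.- (f z ℤ.+ f w) →
        (g (pos x) ℤ.+ g (pos y)) ℤ.- (g (pos z) ℤ.+ g (pos w)) ≡ 0ℤ)

    private
      module _ (b : ℕ → ℤ) (b-top : b d ≡ pos a) (p≡ : ∀ x → p x ≡ polynomial d b x)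
               (approx : Approximation d (radii d H) m b) where

        open Approximation approx

        -- Otherwise m divides t a, hence t by coprimality, although 1 ≤ t ≤ `Q` < m.
        err-top≢0 : err d ≢ 0ℤ
        err-top≢0 err≡0 = <⇒≱ (≤-<-trans t≤∏ Q<m) (∣⇒≤ {{>-nonZero 1≤t}} m∣t)
          where
          m∣t*a : m ∣ a * t
          m∣t*a = subst (m ∣_) (trans (ℤ.abs-* (pos t) (pos a)) (*-comm t a)) (∣⇒∣ᵤ (Signed.divides (near d) (begin
            pos t ℤ.* pos a                  ≡⟨ cong (pos t ℤ.*_) (sym b-top) ⟩
            pos t ℤ.* b d                    ≡⟨ t*b≡ d ⟩
            pos m ℤ.* near d ℤ.+ err d       ≡⟨ cong (λ s → pos m ℤ.* near d ℤ.+ s) err≡0 ⟩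
            pos m ℤ.* near d ℤ.+ 0ℤ          ≡⟨ trans (ℤ.+-identityʳ _) (ℤ.*-comm (pos m) (near d)) ⟩
            near d ℤ.* pos m                 ∎)))
            where open ≡-Reasoning
          m∣t : m ∣ t
          m∣t = coprime-divisor (Coprimality.sym a-coprime) m∣t*a

        from-annihilator : ∀ c → (∃ λ j → 2 ≤ j × j ≤ d × c j ≢ 0ℤ) →
          (∀ {i} → i ≤ d → abs (c i) ≤ coefficient-bound n H) →
          (∀ {u} → Moments u → err · u [ d ] ≡ 0ℤ → c · u [ d ] ≡ 0ℤ) →
          IntegerRelation
        from-annihilator c (j , 2≤j , j≤d , cj≢0) c-≤ c-orthogonal with HasLead-top d c j≤d cj≢0
        ... | 0           , j≤0 , _ , _ , _ = contradiction (≤-trans 2≤j j≤0) λ ()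
        ... | 1           , j≤1 , _ , _ , _ = contradiction (≤-trans 2≤j j≤1) λ { (s≤s ()) }
        ... | suc (suc k) , _ , s≤s (s≤s k≤n) , l≢0 , lead =
          k , c (suc (suc k)) , polynomial d c , k≤n , l≢0 , lead , value-≤ , solves
          where
          value-≤ : ∀ {x} → x ≤ H → abs (polynomial d c (pos x)) ≤ suc d * (coefficient-bound n H * H ^ d)
          value-≤ {x} x≤H = ≤-trans (≤-reflexive (sym (*-identityˡ _))) (abs-Σ≤ d (λ i → c i ℤ.* pos x ℤ.^ i) 1 term-≤)
            where
            term-≤ : ∀ {i} → i ≤ d → 1 * abs (c i ℤ.* pos x ℤ.^ i) ≤ coefficient-bound n H * H ^ d
            term-≤ {i} i≤d = begin
              1 * abs (c i ℤ.* pos x ℤ.^ i)   ≡⟨ trans (*-identityˡ _) (ℤ.abs-* (c i) _) ⟩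
              abs (c i) * abs (pos x ℤ.^ i)   ≡⟨ cong (abs (c i) *_) (abs-pos-^ x i) ⟩
              abs (c i) * x ^ i               ≤⟨ *-mono-≤ (c-≤ i≤d)
                                                   (≤-trans (^-monoˡ-≤ i x≤H) (^-monoʳ-≤ H i≤d)) ⟩
              coefficient-bound n H * H ^ d   ∎
              where open ≤-Reasoning
          solves : ∀ {x y z w} → x ≤ H → y ≤ H → z ≤ H → w ≤ H → pos m ∣ℤ (f x ℤ.+ f y) ℤ.- (f z ℤ.+ f w) → _
          solves {x} {y} {z} {w} x≤ y≤ z≤ w≤ m∣ =
            trans (polynomial-moments d c (pos x) (pos y) (pos z) (pos w))
              (c-orthogonal {u} (refl , u-small)
                (proj₁ (approximation-orthogonal approx {u} u-small (subst (pos m ∣ℤ_) f≡ m∣))))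
            where
            u = moment (pos x) (pos y) (pos z) (pos w)
            u-small = moment-≤ x≤ y≤ z≤ w≤
            f≡ : (f x ℤ.+ f y) ℤ.- (f z ℤ.+ f w) ≡ b · u [ d ]
            f≡ = trans (cong₂ ℤ._-_ (cong₂ ℤ._+_ (p≡ (pos x)) (p≡ (pos y))) (cong₂ ℤ._+_ (p≡ (pos z)) (p≡ (pos w))))
                       (polynomial-moments d b (pos x) (pos y) (pos z) (pos w))

    polynomial-over-ℤ : IntegerRelation
    polynomial-over-ℤ with coefficients {n = d} p-lead
    ... | b , b-top , p≡ =
      let approx = dirichlet d (radii d H) 1≤radii m b
          c , c-top , c-≤ , c-orthogonal =
            small-annihilator (Approximation.err approx) (err-top≢0 b b-top p≡ approx)
      in from-annihilator b b-top p≡ approx c c-top c-≤ (λ {u} → c-orthogonal {u})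

-- Short intervals

largest : {P : ℕ → Set} → Decidable P → P 0 → ∀ n →
          ∃ λ h → h ≤ n × P h × (∀ {k} → h < k → k ≤ n → ¬ P k)
largest P? P0 zero    = 0 , z≤n , P0 , λ 0<k k≤0 → contradiction k≤0 (<⇒≱ 0<k)
largest P? P0 (suc n) with P? (suc n)
... | yes Pn = suc n , ≤-refl , Pn , λ n<k k≤n → contradiction k≤n (<⇒≱ n<k)
... | no ¬Pn with largest P? P0 n
...   | h , h≤n , Ph , max = h , m≤n⇒m≤1+n h≤n , Ph , beyond
  where
  beyond : ∀ {k} → h < k → k ≤ suc n → ¬ _
  beyond {k} h<k k≤1+n with k ≟ suc n
  ... | yes refl = ¬Pn
  ... | no  k≢   = max h<k (≤-pred (≤∧≢⇒< k≤1+n k≢))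

m≤m^n : ∀ m n .{{_ : NonZero n}} → m ≤ m ^ n
m≤m^n zero      n = z≤n
m≤m^n m@(suc _) n = ≤-trans (≤-reflexive (sym (^-identityʳ m))) (^-monoʳ-≤ m (>-nonZero⁻¹ n))

-- The integer part of the n-th root. It turns a bound on a power into a natural number that the
-- counting lemmas accept as a bound.
root : ∀ n .{{_ : NonZero n}} y → ∃ λ r → r ^ n ≤ y × (∀ {t} → t ^ n ≤ y → t ≤ r)
root n y with largest (λ r → r ^ n ≤? y) (0^n≤ n) y
  where
  0^n≤ : ∀ n .{{_ : NonZero n}} → 0 ^ n ≤ y
  0^n≤ (suc n) = z≤n
... | r , _ , r^n≤y , max = r , r^n≤y , λ {t} t^n≤y →
  ≮⇒≥ (λ r<t → max r<t (≤-trans (m≤m^n t n) t^n≤y) t^n≤y)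

^-cancelʳ-≤ : ∀ n .{{_ : NonZero n}} {a b} → a ^ n ≤ b ^ n → a ≤ b
^-cancelʳ-≤ n a^n≤b^n = ≮⇒≥ (λ b<a → <⇒≱ (^-monoˡ-< n b<a) a^n≤b^n)

triangle : ℕ → ℕ
triangle zero    = 0
triangle (suc n) = suc n + triangle n

2*triangle : ∀ n → 2 * triangle n ≡ n * (n + 1)
2*triangle zero    = refl
2*triangle (suc n) = begin
  2 * (suc n + triangle n)       ≡⟨ *-distribˡ-+ 2 (suc n) (triangle n) ⟩
  2 * suc n + 2 * triangle n     ≡⟨ cong (2 * suc n +_) (2*triangle n) ⟩
  2 * suc n + n * (n + 1)        ≡⟨ regroup n ⟩
  suc n * (suc n + 1)            ∎
  where
  open ≡-Reasoning
  regroup : ∀ n → 2 * suc n + n * (n + 1) ≡ suc n * (suc n + 1)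
  regroup = ℕ-Ring.solve-∀

∏≤-cong : ∀ n {g h : ℕ → ℕ} → (∀ i → g i ≡ h i) → ∏≤ n g ≡ ∏≤ n h
∏≤-cong zero    eq = eq 0
∏≤-cong (suc n) eq = cong₂ _*_ (eq 0) (∏≤-cong n (eq ∘ suc))

∏≤-* : ∀ n k g → ∏≤ n (λ i → k * g i) ≡ k ^ suc n * ∏≤ n g
∏≤-* zero    k g = cong (_* g 0) (sym (*-identityʳ k))
∏≤-* (suc n) k g = trans (cong (k * g 0 *_) (∏≤-* n k (g ∘ suc))) (regroup k (g 0) (k ^ suc n) _)
  where
  regroup : ∀ a b c d → a * b * (c * d) ≡ a * c * (b * d)
  regroup = ℕ-Ring.solve-∀

-- Origin of the critical length: the exponents 0, 1, ..., d add up to d(d+1)/2, so Dirichlet's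
-- denominator stays below m while H^(d(d+1)/2) is at most a constant times m.
∏≤-geometric : ∀ n k h → ∏≤ n (λ i → k * h ^ i) ≡ k ^ suc n * h ^ triangle n
∏≤-geometric zero    k h = cong (_* 1) (sym (*-identityʳ k))
∏≤-geometric (suc n) k h = begin
  k * 1 * ∏≤ n (λ i → k * (h * h ^ i))
    ≡⟨ cong (k * 1 *_) (trans (∏≤-cong n (λ i → swap k h (h ^ i))) (∏≤-* n h _)) ⟩
  k * 1 * (h ^ suc n * ∏≤ n (λ i → k * h ^ i))
    ≡⟨ cong (λ s → k * 1 * (h ^ suc n * s)) (∏≤-geometric n k h) ⟩
  k * 1 * (h ^ suc n * (k ^ suc n * h ^ triangle n))
    ≡⟨ regroup k (h ^ suc n) (k ^ suc n) (h ^ triangle n) ⟩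
  k * k ^ suc n * (h ^ suc n * h ^ triangle n)
    ≡⟨ cong (k * k ^ suc n *_) (sym (^-distribˡ-+-* h (suc n) (triangle n))) ⟩
  k ^ suc (suc n) * h ^ triangle (suc n) ∎
  where
  open ≡-Reasoning
  swap : ∀ a b c → a * (b * c) ≡ b * (a * c)
  swap = ℕ-Ring.solve-∀
  regroup : ∀ a b c d → a * 1 * (b * (c * d)) ≡ a * c * (b * d)
  regroup = ℕ-Ring.solve-∀

module _ (n : ℕ) where

  private
    d = suc (suc n)
    s = triangle d
    α = suc (4 * suc d) ^ suc d
    β = suc n * 4 + 1

  -- The exponent adds s from Dirichlet's denominator, d from `linear-factor` and d from the powers
  -- of x.
  value-bound : ∀ H .{{_ : NonZero H}} →
    suc d * (coefficient-bound n H * H ^ d) ≤ suc d * (α * β + 1) * H ^ (d + d + s)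
  value-bound H = begin
    suc d * ((∏≤ d (radii d H) * suc (suc n * (4 * h)) + 1) * h)
      ≡⟨ cong (λ Q → suc d * ((Q * suc (suc n * (4 * h)) + 1) * h)) (∏≤-geometric d (suc (4 * suc d)) H) ⟩
    suc d * ((α * r * suc (suc n * (4 * h)) + 1) * h)
      ≤⟨ *-monoʳ-≤ (suc d) (*-monoˡ-≤ h (+-mono-≤ (*-monoʳ-≤ (α * r) linear-≤) 1≤rh)) ⟩
    suc d * ((α * r * (β * h) + r * h) * h)
      ≡⟨ regroup (suc d) α r β h ⟩
    suc d * (α * β + 1) * (h * h * r)
      ≡⟨ cong (suc d * (α * β + 1) *_) (sym (trans (^-distribˡ-+-* H (d + d) s) (cong (_* r) (^-distribˡ-+-* H d d)))) ⟩
    suc d * (α * β + 1) * H ^ (d + d + s) ∎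
    where
    open ≤-Reasoning
    h = H ^ d
    r = H ^ s
    1≤h = m^n>0 H d
    1≤rh : 1 ≤ r * h
    1≤rh = *-mono-≤ (m^n>0 H s) 1≤h
    linear-≤ : suc (suc n * (4 * h)) ≤ β * h
    linear-≤ = ≤-trans (+-monoˡ-≤ (suc n * (4 * h)) 1≤h) (≤-reflexive (collect h (suc n)))
      where
      collect : ∀ h n → h + n * (4 * h) ≡ (n * 4 + 1) * h
      collect = ℕ-Ring.solve-∀
    regroup : ∀ e a q b h → e * ((a * q * (b * h) + q * h) * h) ≡ e * (a * b + 1) * (h * h * q)
    regroup = ℕ-Ring.solve-∀

  module _ (N : ℕ) .{{_ : NonZero N}} where

    private
      A′ = d + d + s

      instance
        NA≢0 : NonZero (N * A′)
        NA≢0 = m*n≢0 N A′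

      -- Divisor bound with ε = 1/(N A′): values of size H^A′ then have t divisors with t^N at most
      -- a constant times H.
      C₀ = proj₁ (divisor-bound (N * A′))
      -- The successor gives c₁ H ≥ 1, hence R ≥ 1, which lets `E * R` absorb the term without R.
      c₁ = suc (C₀ * (2 * (suc d * (α * β + 1))))
      E  = d * d + 2 * d

    short-energy-constant : ℕ
    short-energy-constant = E ^ N * c₁

    -- The N-th power of a bound O(H^(2 + 1/N)). The constant depends on the degree and N alone, so
    -- it serves every shifted block.
    short-energy-bound : ∀ m .{{_ : NonZero m}} {a} → Coprime a m → ∀ p → HasLead d (pos a) p →
      ∀ H → 1 ≤ H → ∏≤ d (radii d H) < m → let f = λ x → p (pos x) in
      Energy.energy m (interval H) f f f f ^ N ≤ short-energy-constant * H ^ (2 * N) * H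
    short-energy-bound m coprime p p-lead H 1≤H Q<m =
      from-integer-relation (polynomial-over-ℤ n H 1≤H m Q<m coprime p p-lead) (root N (c₁ * H))
      where
      open Energy m
      open ≤-Reasoning
      instance
        H≢0 : NonZero H
        H≢0 = >-nonZero 1≤H
      f : ℕ → ℤ
      f x = p (pos x)
      V = suc d * (coefficient-bound n H * H ^ d)
      from-integer-relation : IntegerRelation n H 1≤H m Q<m coprime p p-lead →
        (∃ λ r → r ^ N ≤ c₁ * H × (∀ {t} → t ^ N ≤ c₁ * H → t ≤ r)) →
        energy (interval H) f f f f ^ N ≤ short-energy-constant * H ^ (2 * N) * H
      from-integer-relation (k , l , g , k≤n , l≢0 , g-lead , g-≤ , solves) (R , R^N≤ , R-max) = begin
        energy (interval H) f f f f ^ N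
          ≤⟨ ^-monoˡ-≤ N (≤-trans energy≤ integer-energy-≤) ⟩
        (H * H * (D * D + 2 * D * R)) ^ N
          ≤⟨ ^-monoˡ-≤ N (*-monoʳ-≤ (H * H) degree-≤) ⟩
        (H * H * (E * R)) ^ N
          ≡⟨ trans (^-distribʳ-* N (H * H) (E * R)) (cong₂ _*_ H*H^N (^-distribʳ-* N E R)) ⟩
        H ^ (2 * N) * (E ^ N * R ^ N)
          ≤⟨ *-monoʳ-≤ (H ^ (2 * N)) (*-monoʳ-≤ (E ^ N) R^N≤) ⟩
        H ^ (2 * N) * (E ^ N * (c₁ * H))
          ≡⟨ regroup (H ^ (2 * N)) (E ^ N) c₁ H ⟩
        short-energy-constant * H ^ (2 * N) * H ∎
        where
        D = suc (suc k)

        1≤R : 1 ≤ R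
        1≤R = R-max (≤-trans (≤-reflexive (^-zeroˡ N)) (*-mono-≤ (s≤s (z≤n {C₀ * (2 * (suc d * (α * β + 1)))})) 1≤H))

        degree-≤ : D * D + 2 * D * R ≤ E * R
        degree-≤ = begin
          D * D + 2 * D * R       ≤⟨ +-mono-≤ (*-mono-≤ D≤d D≤d) (*-monoˡ-≤ R (*-monoʳ-≤ 2 D≤d)) ⟩
          d * d + 2 * d * R       ≤⟨ +-monoˡ-≤ (2 * d * R) (m≤m*n (d * d) R {{>-nonZero 1≤R}}) ⟩
          d * d * R + 2 * d * R   ≡⟨ sym (*-distribʳ-+ R (d * d) (2 * d)) ⟩
          E * R                   ∎
          where
          D≤d : D ≤ d
          D≤d = s≤s (s≤s k≤n)

        H*H^N : (H * H) ^ N ≡ H ^ (2 * N)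
        H*H^N = trans (cong (λ h → (H * h) ^ N) (sym (*-identityʳ H))) (^-*-assoc H 2 N)

        regroup : ∀ a b c h → a * (b * (c * h)) ≡ b * c * a * h
        regroup = ℕ-Ring.solve-∀

        few-divisors : ∀ {y w} → y ∈ interval H → w ∈ interval H →
          g (pos w) ℤ.- g (pos y) ≢ 0ℤ → AtMost R (_∣ abs (g (pos w) ℤ.- g (pos y)))
        few-divisors {y} {w} y∈ w∈ v≢0 xs unique all =
          conclude (proj₂ (divisor-bound (N * A′)) v {{≢-nonZero (v≢0 ∘ ℤ.∣i∣≡0⇒i≡0)}})
          where
          v = abs (g (pos w) ℤ.- g (pos y))
          v≤ : v ≤ 2 * V
          v≤ = ≤-trans (ℤ.∣i-j∣≤∣i∣+∣j∣ (g (pos w)) (g (pos y)))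
            (≤-trans (+-mono-≤ (g-≤ (proj₂ (∈-interval⁻ w∈))) (g-≤ (proj₂ (∈-interval⁻ y∈))))
                     (≤-reflexive (cong (V +_) (sym (+-identityʳ V)))))
          conclude : (∃ λ t → AtMost t (_∣ v) × t ^ (N * A′) ≤ C₀ * v) → length xs ≤ R
          conclude (t , atMost , t^NA≤) = ≤-trans (atMost xs unique all) (R-max (^-cancelʳ-≤ A′ (begin
            (t ^ N) ^ A′                                           ≡⟨ ^-*-assoc t N A′ ⟩
            t ^ (N * A′)                                           ≤⟨ t^NA≤ ⟩
            C₀ * v                                                 ≤⟨ *-monoʳ-≤ C₀ v≤ ⟩
            C₀ * (2 * V)                                           ≤⟨ *-monoʳ-≤ C₀ (*-monoʳ-≤ 2 (value-bound H)) ⟩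
            C₀ * (2 * (suc d * (α * β + 1) * H ^ A′))              ≡⟨ assoc C₀ (suc d * (α * β + 1)) (H ^ A′) ⟩
            C₀ * (2 * (suc d * (α * β + 1))) * H ^ A′              ≤⟨ *-monoˡ-≤ (H ^ A′) (≤-trans (n≤1+n _) (m≤m^n c₁ A′)) ⟩
            c₁ ^ A′ * H ^ A′                                       ≡⟨ sym (^-distribʳ-* A′ c₁ H) ⟩
            (c₁ * H) ^ A′                                          ∎)))
            where
            assoc : ∀ a b c → a * (2 * (b * c)) ≡ a * (2 * b) * c
            assoc = ℕ-Ring.solve-∀

        open PolynomialEnergy g k g-lead l≢0 H R few-divisors

        energy≤ : energy (interval H) f f f f ≤ integer-energy
        energy≤ = ∑-mono-∈ (interval H ²) (λ {P} P∈ → ∑-mono-∈ (interval H ²) (λ {Q} Q∈ →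
          𝟙-mono (pos m ∣ℤ? (f (proj₁ P) ℤ.+ f (proj₂ P)) ℤ.- (f (proj₁ Q) ℤ.+ f (proj₂ Q))) (_ ℤ.≟ 0ℤ)
            (solves (fst-≤ P∈) (snd-≤ P∈) (fst-≤ Q∈) (snd-≤ Q∈))))
          where
          fst-≤ : ∀ {P} → P ∈ interval H ² → proj₁ P ≤ H
          fst-≤ P∈ = proj₂ (∈-interval⁻ (proj₁ (∈-cartesianProduct⁻ (interval H) (interval H) P∈)))
          snd-≤ : ∀ {P} → P ∈ interval H ² → proj₂ P ≤ H
          snd-≤ P∈ = proj₂ (∈-interval⁻ (proj₂ (∈-cartesianProduct⁻ (interval H) (interval H) P∈)))

-- Arbitrary intervals

cover : ∀ h H .{{_ : NonZero h}} → h ≤ H → ∃ λ k → H ≤ k * h × k * h ≤ 2 * H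
cover h H h≤H = suc (H / h) ,
  (begin
    H                    ≡⟨ m≡m%n+[m/n]*n H h ⟩
    H % h + H / h * h    ≤⟨ +-monoˡ-≤ (H / h * h) (<⇒≤ (m%n<n H h)) ⟩
    suc (H / h) * h      ∎) ,
  (begin
    h + H / h * h                ≤⟨ +-mono-≤ h≤H (m≤n+m (H / h * h) (H % h)) ⟩
    H + (H % h + H / h * h)      ≡⟨ cong (H +_) (sym (m≡m%n+[m/n]*n H h)) ⟩
    H + H                        ≡⟨ cong (H +_) (sym (+-identityʳ H)) ⟩
    2 * H                        ∎)
  where open ≤-Reasoning

module _ (n k : ℕ) (1≤k : 1 ≤ k) where

  private
    d = suc (suc n)
    -- The power N turns m^(4/(d(d+1))) into m^(4k) and H^(1/k) into H^(d(d+1)).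
    N = d * (d + 1) * k

    instance
      k≢0 : NonZero k
      k≢0 = >-nonZero 1≤k
      N≢0 : NonZero N
      N≢0 = m*n≢0 (d * (d + 1)) k

    s  = triangle d
    K  = suc (4 * suc d) ^ suc d
    C₁ = short-energy-constant n N
    C₂ = K ^ (4 * k)
    C₃ = (K * 2 ^ s) ^ (4 * k)

    s*4k≡2N : s * (4 * k) ≡ 2 * N
    s*4k≡2N = begin
      s * (4 * k)               ≡⟨ regroup s k ⟩
      2 * (2 * s * k)           ≡⟨ cong (λ e → 2 * (e * k)) (2*triangle d) ⟩
      2 * N                     ∎
      where
      open ≡-Reasoning
      regroup : ∀ s k → s * (4 * k) ≡ 2 * (2 * s * k)
      regroup = ℕ-Ring.solve-∀

  constant : ℕ
  constant = C₂ + C₁ + C₁ * C₃ * 2 ^ (4 * N)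

  module _ (m : ℕ) .{{_ : NonZero m}} (a : Fin (suc d) → ℕ) (coprime : Coprime (lead d a) m)
           (H : ℕ) (1≤H : 1 ≤ H) where

    private
      open Energy m
      open ≤-Reasoning

      instance
        H≢0 : NonZero H
        H≢0 = >-nonZero 1≤H

      F : ℤ → ℤ
      F = proj₁ (evalPoly-HasLead d a)

      F-lead : HasLead d (pos (lead d a)) F
      F-lead = proj₁ (proj₂ (evalPoly-HasLead d a))

      f : ℕ → ℤ
      f x = F (pos x)

      diagonal : ℕ → (ℕ → ℤ) → ℕ
      diagonal H f = energy (interval H) f f f f

      T≤ : T m d a H ≤ diagonal H f
      T≤ = T≤energy d a H f (proj₂ (proj₂ (evalPoly-HasLead d a)))

      M = m ^ (4 * k)

      -- Covers moduli so small that not even length 1 is below the critical length; all H⁴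
      -- quadruples may be counted.
      trivial-case : m ≤ K → T m d a H ^ N * M ≤ C₂ * H ^ (4 * N)
      trivial-case m≤K = begin
        T m d a H ^ N * M          ≤⟨ *-mono-≤ (^-monoˡ-≤ N T≤H⁴) (^-monoˡ-≤ (4 * k) m≤K) ⟩
        (H ^ 4) ^ N * C₂           ≡⟨ cong (_* C₂) (^-*-assoc H 4 N) ⟩
        H ^ (4 * N) * C₂           ≡⟨ *-comm (H ^ (4 * N)) C₂ ⟩
        C₂ * H ^ (4 * N)           ∎
        where
        T≤H⁴ : T m d a H ≤ H ^ 4
        T≤H⁴ = begin
          T m d a H     ≤⟨ T≤ ⟩
          diagonal H f  ≤⟨ ∑-²-≤-const (interval H) (λ P → ∑-²-≤-const (interval H) (λ Q → 𝟙-≤1 (pos m ∣ℤ? _))) ⟩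
          l * (l * (l * (l * 1)))    ≡⟨ cong (λ l → l * (l * (l * (l * 1)))) (interval-length H) ⟩
          H ^ 4         ∎
          where l = length (interval H)

      short-case : ∏≤ d (radii d H) < m → T m d a H ^ N * M ≤ C₁ * (H ^ (2 * N) * M) * H
      short-case Q<m = begin
        T m d a H ^ N * M                   ≤⟨ *-monoˡ-≤ M (^-monoˡ-≤ N T≤) ⟩
        diagonal H f ^ N * M                ≤⟨ *-monoˡ-≤ M (short-energy-bound n N m coprime F F-lead H 1≤H Q<m) ⟩
        C₁ * H ^ (2 * N) * H * M            ≡⟨ regroup C₁ (H ^ (2 * N)) H M ⟩
        C₁ * (H ^ (2 * N) * M) * H          ∎
        where
        regroup : ∀ a b c e → a * b * c * e ≡ a * (b * e) * c
        regroup = ℕ-Ring.solve-∀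

      -- At the critical length m is O(h^s), so m^(4k) is O(h^(2N)). With b blocks, b^(4N) · h^(2N)
      -- h · h^(2N) = (bh)^(4N) h, and bh ≤ 2H.
      long-case : ∀ h → 1 ≤ h → h ≤ H → ∏≤ d (radii d h) < m → m ≤ ∏≤ d (radii d (suc h)) →
                  T m d a H ^ N * M ≤ C₁ * C₃ * 2 ^ (4 * N) * H ^ (4 * N) * H
      long-case h 1≤h h≤H Q<m m≤Q′ = assemble (cover h H {{>-nonZero 1≤h}} h≤H) (root N (C₁ * h ^ (2 * N) * h))
        where
        shifted-lead : ∀ r → HasLead d (pos (lead d a)) (λ x → F (pos r ℤ.+ x))
        shifted-lead r = HasLead-≗ {n = d} (λ x → cong F (ℤ.+-comm (pos r) x)) (HasLead-shift {n = d} (pos r) F-lead)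

        M≤ : M ≤ C₃ * h ^ (2 * N)
        M≤ = begin
          m ^ (4 * k)                              ≤⟨ ^-monoˡ-≤ (4 * k) m≤Q′ ⟩
          ∏≤ d (radii d (suc h)) ^ (4 * k)         ≡⟨ cong (_^ (4 * k)) (∏≤-geometric d (suc (4 * suc d)) (suc h)) ⟩
          (K * suc h ^ s) ^ (4 * k)                ≤⟨ ^-monoˡ-≤ (4 * k) (*-monoʳ-≤ K (^-monoˡ-≤ s 1+h≤2h)) ⟩
          (K * (2 * h) ^ s) ^ (4 * k)              ≡⟨ cong (λ q → (K * q) ^ (4 * k)) (^-distribʳ-* s 2 h) ⟩
          (K * (2 ^ s * h ^ s)) ^ (4 * k)          ≡⟨ cong (_^ (4 * k)) (sym (*-assoc K (2 ^ s) (h ^ s))) ⟩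
          (K * 2 ^ s * h ^ s) ^ (4 * k)            ≡⟨ ^-distribʳ-* (4 * k) (K * 2 ^ s) (h ^ s) ⟩
          C₃ * (h ^ s) ^ (4 * k)                   ≡⟨ cong (C₃ *_) (trans (^-*-assoc h s (4 * k)) (cong (h ^_) s*4k≡2N)) ⟩
          C₃ * h ^ (2 * N)                         ∎
          where
          1+h≤2h : suc h ≤ 2 * h
          1+h≤2h = +-mono-≤ 1≤h (≤-reflexive (sym (+-identityʳ h)))

        assemble : (∃ λ b → H ≤ b * h × b * h ≤ 2 * H) →
                   (∃ λ B → B ^ N ≤ C₁ * h ^ (2 * N) * h × (∀ {t} → t ^ N ≤ C₁ * h ^ (2 * N) * h → t ≤ B)) →
                   T m d a H ^ N * M ≤ C₁ * C₃ * 2 ^ (4 * N) * H ^ (4 * N) * H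
        assemble (b , H≤bh , bh≤2H) (B , B^N≤ , B-max) = begin
          T m d a H ^ N * M
            ≤⟨ *-mono-≤ (^-monoˡ-≤ N T≤blocks) M≤ ⟩
          (b ^ 4 * B) ^ N * (C₃ * h ^ (2 * N))
            ≡⟨ cong (_* (C₃ * h ^ (2 * N))) (^-distribʳ-* N (b ^ 4) B) ⟩
          (b ^ 4) ^ N * B ^ N * (C₃ * h ^ (2 * N))
            ≤⟨ *-monoˡ-≤ (C₃ * h ^ (2 * N)) (*-monoʳ-≤ ((b ^ 4) ^ N) B^N≤) ⟩
          (b ^ 4) ^ N * (C₁ * h ^ (2 * N) * h) * (C₃ * h ^ (2 * N))
            ≡⟨ regroup ((b ^ 4) ^ N) C₁ (h ^ (2 * N)) h C₃ ⟩
          C₁ * C₃ * ((b ^ 4) ^ N * (h ^ (2 * N) * h ^ (2 * N))) * h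
            ≡⟨ cong (λ q → C₁ * C₃ * q * h) powers ⟩
          C₁ * C₃ * (b * h) ^ (4 * N) * h
            ≤⟨ *-mono-≤ (*-monoʳ-≤ (C₁ * C₃) (^-monoˡ-≤ (4 * N) bh≤2H)) h≤H ⟩
          C₁ * C₃ * (2 * H) ^ (4 * N) * H
            ≡⟨ cong (_* H) (trans (cong (C₁ * C₃ *_) (^-distribʳ-* (4 * N) 2 H)) (sym (*-assoc (C₁ * C₃) _ _))) ⟩
          C₁ * C₃ * 2 ^ (4 * N) * H ^ (4 * N) * H ∎
          where
          T≤blocks : T m d a H ≤ b ^ 4 * B
          T≤blocks = begin
            T m d a H             ≤⟨ T≤ ⟩
            diagonal H f          ≤⟨ energy-interval-mono H≤bh f ⟩
            diagonal (b * h) f    ≤⟨ energy-blocks b h f (λ r → B-max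
                                       (short-energy-bound n N m coprime _ (shifted-lead r) h 1≤h Q<m)) ⟩
            b * b * (b * b * B)   ≡⟨ fourth b B ⟩
            b ^ 4 * B             ∎
            where
            fourth : ∀ b B → b * b * (b * b * B) ≡ b * (b * (b * (b * 1))) * B
            fourth = ℕ-Ring.solve-∀
          powers : (b ^ 4) ^ N * (h ^ (2 * N) * h ^ (2 * N)) ≡ (b * h) ^ (4 * N)
          powers = trans
            (cong₂ _*_ (^-*-assoc b 4 N) (trans (sym (^-distribˡ-+-* h (2 * N) (2 * N))) (cong (h ^_) (double N))))
            (sym (^-distribʳ-* (4 * N) b h))
            where
            double : ∀ N → 2 * N + 2 * N ≡ 4 * N
            double = ℕ-Ring.solve-∀
          regroup : ∀ b c q h c′ → b * (c * q * h) * (c′ * q) ≡ c * c′ * (b * (q * q)) * h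
          regroup = ℕ-Ring.solve-∀

      Z = H ^ (4 * N) + H ^ (2 * N) * M

      -- The short and long cases lose one factor H, which is within the allowed loss H^(d(d+1)).
      H≤ : H ≤ H ^ (d * (d + 1))
      H≤ = m≤m^n H (d * (d + 1))

      conclude : ∀ {c z} → c ≤ constant → z ≤ Z → c * z * H ≤ constant * Z * H ^ (d * (d + 1))
      conclude c≤ z≤ = *-mono-≤ (*-mono-≤ c≤ z≤) H≤

    energy-bound : T m d a H ^ N * M ≤ constant * Z * H ^ (d * (d + 1))
    energy-bound with largest (λ h → ∏≤ d (radii d h) <? m) degenerate H
      where
      -- For h = 0 the factors with i ≥ 1 vanish, so the search for the critical length always has a
      -- starting point.
      degenerate : ∏≤ d (radii d 0) < m
      degenerate = ≤-<-trans (≤-reflexive (trans (∏≤-geometric d (suc (4 * suc d)) 0) (*-zeroʳ K))) (>-nonZero⁻¹ m)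
    ... | h , h≤H , Q<m , max with h ≟ H
    ...   | yes refl = ≤-trans (short-case Q<m) (conclude (m≤n⇒m≤n+o _ (m≤n+m C₁ C₂)) (m≤n+m _ _))
    ...   | no h≢H with h
    ...     | zero = ≤-trans (trivial-case m≤K)
      (≤-trans (m≤m*n _ H) (conclude (m≤n⇒m≤n+o _ (m≤m+n C₂ C₁)) (m≤m+n _ _)))
      where
      m≤K : m ≤ K
      m≤K = ≤-trans (≮⇒≥ (max (s≤s z≤n) 1≤H)) (≤-reflexive (begin-equality
        ∏≤ d (radii d 1)     ≡⟨ ∏≤-geometric d (suc (4 * suc d)) 1 ⟩
        K * 1 ^ s            ≡⟨ cong (K *_) (^-zeroˡ s) ⟩
        K * 1                ≡⟨ *-identityʳ K ⟩
        K                    ∎))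
    ...     | suc h′ = ≤-trans
      (long-case (suc h′) (s≤s z≤n) h≤H Q<m (≮⇒≥ (max ≤-refl (≤∧≢⇒< h≤H h≢H))))
      (conclude (m≤n+m _ (C₂ + C₁)) (m≤m+n _ _))

-- Here ε = 1/k. Taking the root of order d(d+1)k, which is subadditive, and dividing by
-- m^(4/(d(d+1))) gives the bound with H^(o(1)) replaced by a constant times H^(1/k); C is chosen
-- before m, the coefficients and H.
theorem1p3 : (d : ℕ) → 2 ≤ d → (k : ℕ) → 1 ≤ k →
    ∃ λ (C : ℕ) →
    (m : ℕ) .{{_ : NonZero m}} → 2 ≤ m →
    (a : Fin (suc d) → ℕ) → Coprime (lead d a) m →
    (H : ℕ) → 1 ≤ H → H ≤ m →
    T m d a H ^ (d * (d + 1) * k) * m ^ (4 * k)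
    ≤ C * (H ^ (4 * (d * (d + 1) * k)) + H ^ (2 * (d * (d + 1) * k)) * m ^ (4 * k))
    * H ^ (d * (d + 1))
theorem1p3 (suc (suc n)) (s≤s (s≤s z≤n)) k 1≤k =
  constant n k 1≤k , λ m _ a coprime H 1≤H _ → energy-bound n k 1≤k m a coprime H 1≤H
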